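{- For every integer $n\ge 4$, there exists an acyclic digraph $H$ on $n$ vertices with maximum degree $3$ for which $$\overrightarrow{r_k}(H)\ \ge\ n^{\log n/(20\log\log n)}$$ for all $k\ge 2$.
   Context: All digraphs are finite, simple and oriented (no loops, parallel or anti-parallel edges). The maximum degree of $H$ is $\max_{v}(|N^+(v)|+|N^-(v)|)$. A copy of $H$ in $T$ is given by an injective map $V(H)\to V(T)$ sending edges of $H$ to edges of $T$ with orientations preserved. For an acyclic digraph $H$ and $k\ge1$, $\overrightarrow{r_k}(H)$ is the least $N$ such that every tournament on $N$ vertices whose edges are colored with $k$ colors contains a monochromatic copy of $H$. All logarithms are to base $2$. -}

module Defs where

open import Algebra.Definitions.RawSemiring using (_^_)
open import Data.Bool.Base using (Bool; T)
open import Data.Fin.Base using (Fin)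
open import Data.Fin.Subset using (Subset; ∣_∣)
open import Data.Integer.Base as ℤ using (+_)
open import Data.List.Base using (map; allFin)
open import Data.List.Extrema.Nat using (max)
open import Data.Nat.Base as ℕ using (ℕ)
open import Data.Product.Base using (Σ; Σ-syntax; ∃-syntax; _×_; _,_; proj₁)
open import Data.Rational.Base as ℚ using (ℚ; Positive; ↥_; ↧ₙ_; _/_; +-*-rawSemiring)
open import Data.Sum.Base using (_⊎_)
open import Data.Vec.Base using (tabulate)
open import Function.Definitions using (Injective)
open import Relation.Binary.Construct.Closure.Transitive using (TransClosure)
open import Relation.Binary.Definitions using (Asymmetric; Irreflexive)
open import Relation.Binary.PropositionalEquality.Core using (_≡_; _≢_)

------------------------------------------------------------------------
-- Digraphs and tournaments

-- Asymmetry excludes loops as well as anti-parallel edges.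
record Digraph (n : ℕ) : Set where
  field
    adj  : Fin n → Fin n → Bool
    asym : Asymmetric (λ u v → T (adj u v))

open Digraph public

infix 4 _[_⟶_]
_[_⟶_] : ∀ {n} → Digraph n → Fin n → Fin n → Set
G [ u ⟶ v ] = T (adj G u v)

N⁺ N⁻ : ∀ {n} → Digraph n → Fin n → Subset n
N⁺ G v = tabulate (λ w → adj G v w)
N⁻ G v = tabulate (λ w → adj G w v)

degree : ∀ {n} → Digraph n → Fin n → ℕ
degree G v = ∣ N⁺ G v ∣ ℕ.+ ∣ N⁻ G v ∣

maxDegree : ∀ {n} → Digraph n → ℕ
maxDegree {n} G = max 0 (map (degree G) (allFin n))

-- The transitive closure relates u to v when there is a directed walk of
-- positive length from u to v.
Acyclic : ∀ {n} → Digraph n → Set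
Acyclic G = Irreflexive _≡_ (TransClosure (G [_⟶_]))

IsTournament : ∀ {n} → Digraph n → Set
IsTournament G = ∀ {u v} → u ≢ v → G [ u ⟶ v ] ⊎ G [ v ⟶ u ]

------------------------------------------------------------------------
-- Oriented Ramsey numbers

record Copy {n N} (H : Digraph n) (G : Digraph N) : Set where
  field
    vertex    : Fin n → Fin N
    injective : Injective _≡_ _≡_ vertex
    edge      : ∀ {u v} → H [ u ⟶ v ] → G [ vertex u ⟶ vertex v ]

open Copy public

-- T is proof-irrelevant, so each edge receives exactly one colour.
EdgeColouring : ∀ {N} → ℕ → Digraph N → Set
EdgeColouring k G = ∀ {u v} → G [ u ⟶ v ] → Fin k

Monochromatic : ∀ {n N k} {H : Digraph n} {G : Digraph N} →
                EdgeColouring k G → Copy H G → Set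
Monochromatic {k = k} {H} c φ =
  Σ[ i ∈ Fin k ] (∀ {u v} (e : H [ u ⟶ v ]) → c (edge φ e) ≡ i)

Arrows : ∀ {n} → ℕ → Digraph n → ℕ → Set
Arrows k H N =
  (G : Digraph N) → IsTournament G → (c : EdgeColouring k G) →
  Σ[ φ ∈ Copy H G ] Monochromatic {H = H} {G} c φ

IsRamseyNumber : ∀ {n} → ℕ → Digraph n → ℕ → Set
IsRamseyNumber k H r = Arrows k H r × (∀ N → Arrows k H N → r ℕ.≤ N)

------------------------------------------------------------------------
-- Positive real numbers

ℚ⁺ : Set
ℚ⁺ = Σ ℚ Positive

value : ℚ⁺ → ℚ
value = proj₁

infixr 8 _^ᵠ_
_^ᵠ_ : ℚ → ℕ → ℚ
_^ᵠ_ = _^_ +-*-rawSemiring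

num den : ℚ⁺ → ℕ
num p = ℤ.∣ ↥ value p ∣
den p = ↧ₙ value p

-- Comparison of c with the possibly irrational b ^ p, where p = num p / den p:
-- both sides are raised to the power den p.
infix 4 _≤[_^_] [_^_]≤_
_≤[_^_] : ℚ⁺ → ℚ⁺ → ℚ⁺ → Set
c ≤[ b ^ p ] = value c ^ᵠ den p ℚ.≤ value b ^ᵠ num p

[_^_]≤_ : ℚ⁺ → ℚ⁺ → ℚ⁺ → Set
[ b ^ p ]≤ c = value b ^ᵠ num p ℚ.≤ value c ^ᵠ den p

2⁺ : ℚ⁺
2⁺ = (+ 2 / 1) , _

-- A real number x > 0 is presented by its Dedekind cut in the positive
-- rationals: `lower x q` means q < x and `upper x q` means x < q.  The cut
-- axioms are not part of the record; each operation below gives the two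
-- strict inequalities by an exact criterion on its stated domain.
record ℝ⁺ : Set₁ where
  field
    lower upper : ℚ⁺ → Set

open ℝ⁺ public

infix 4 _≤ᴿ_
_≤ᴿ_ : ℝ⁺ → ℝ⁺ → Set
x ≤ᴿ y = ∀ q → lower x q → lower y q

ι : ℕ → ℝ⁺
lower (ι m) q = value q ℚ.< + m / 1
upper (ι m) q = + m / 1 ℚ.< value q

infixl 7 _*ᴿ_ _/ᴿ_
_*ᴿ_ : ℝ⁺ → ℝ⁺ → ℝ⁺
lower (x *ᴿ y) q = ∃[ a ] ∃[ b ] lower x a × lower y b × value q ℚ.≤ value a ℚ.* value b
upper (x *ᴿ y) q = ∃[ a ] ∃[ b ] upper x a × upper y b × value a ℚ.* value b ℚ.≤ value q

_/ᴿ_ : ℝ⁺ → ℝ⁺ → ℝ⁺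
lower (x /ᴿ y) q = ∃[ a ] ∃[ b ] lower x a × upper y b × value q ℚ.* value b ℚ.≤ value a
upper (x /ᴿ y) q = ∃[ a ] ∃[ b ] upper x a × lower y b × value a ℚ.≤ value q ℚ.* value b

-- For x > 1: q < log₂ x iff 2 ^ q ≤ a for some rational a < x, and dually.
log₂ : ℝ⁺ → ℝ⁺
lower (log₂ x) q = ∃[ a ] lower x a × [ 2⁺ ^ q ]≤ a
upper (log₂ x) q = ∃[ a ] upper x a × a ≤[ 2⁺ ^ q ]

-- For x > 1: x ^ y is the supremum of a ^ p over positive rationals a < x and
-- p < y, and the infimum over a > x and p > y.
infixr 8 _^ᴿ_
_^ᴿ_ : ℝ⁺ → ℝ⁺ → ℝ⁺
lower (x ^ᴿ y) q = ∃[ a ] ∃[ p ] lower x a × lower y p × q ≤[ a ^ p ]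
upper (x ^ᴿ y) q = ∃[ a ] ∃[ p ] upper x a × upper y p × [ a ^ p ]≤ q

{-# OPTIONS --safe #-}

-- H consists of a Hamiltonian path together with a matching: q² of its vertices
-- form q consecutive cells of length q, with one matching edge between any two
-- cells.  In a transitive tournament the path forces copies of H to be increasing.
--
-- Let χ be a 2-colouring of the pairs of t points without monochromatic cliques
-- on more than K points, and colour the pairs of t ^ d points lexicographically
-- by χ.  When w consecutive cells are embedded, fewer than t of them meet several
-- of the t top-level blocks, while the blocks that contain a cell form a
-- monochromatic clique of χ.  So some block contains about (w - t) / K
-- consecutive cells, and iterating shows that q ≈ t * K ^ (d - 1) cells do not
-- fit into t ^ d points.  With t ≈ n ^ (1/4), K ≈ log n / 2 and q ≈ √n this gives
-- r > t ^ d ≈ n ^ (log n / (16 log log n)).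
--
-- When log n < 36, the exponent is at most 1 and the trivial bound r ≥ n suffices.

module Submission where

import Algebra.Properties.CommutativeMonoid.Sum
open import Data.Bool.Base using (Bool; true; false; T; if_then_else_)
import Data.Bool.Properties as Bool
open import Data.Empty using (⊥; ⊥-elim)
open import Data.Fin.Base as Fin using (Fin; toℕ; fromℕ<)
open import Data.Fin.Properties using (toℕ-injective; toℕ<n; toℕ-fromℕ<; injective⇒≤)
open import Data.Fin.Subset using (∣_∣)
open import Data.Integer.Base as ℤ using (+[1+_])
import Data.Integer.Properties as ℤ
open import Data.List.Base using (List; []; _∷_; _++_; map; length; allFin)
open import Data.List.Extrema.Nat using (max≤v⁺; v≤max⁺)
open import Data.List.Membership.Propositional using (_∈_; lose)
open import Data.List.Membership.Propositional.Properties using (∈-map⁺; ∈-++⁺ˡ; ∈-++⁺ʳ; ∈-allFin)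
open import Data.List.Properties using (length-map; length-++)
open import Data.List.Relation.Unary.All as All using (All; []; _∷_)
import Data.List.Relation.Unary.All.Properties as All
open import Data.List.Relation.Unary.AllPairs as AllPairs using (AllPairs; []; _∷_)
import Data.List.Relation.Unary.AllPairs.Properties as AllPairs
open import Data.List.Relation.Unary.Any using (here)
open import Data.Nat.Base
open import Data.Nat.Divisibility using (divides-refl)
open import Data.Nat.DivMod
open import Data.Nat.ListAction using (sum)
open import Data.Nat.Properties
open import Data.Nat.Tactic.RingSolver using (solve-∀)
open import Data.Product.Base using (Σ-syntax; ∃-syntax; _×_; _,_; proj₁; proj₂)
open import Data.Rational.Base as ℚ using (ℚ; mkℚ; toℚᵘ)
import Data.Rational.Properties as ℚ
open import Data.Rational.Unnormalised.Base as ℚᵘ using (mkℚᵘ)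
import Data.Rational.Unnormalised.Properties as ℚᵘ
open import Data.Sum.Base as Sum using (_⊎_; inj₁; inj₂)
open import Data.Vec.Base using (tabulate)
open import Function.Base using (_∘_)
open import Relation.Binary.Construct.Closure.Transitive using (TransClosure; [_]; _∷_)
open import Relation.Binary.Definitions using (tri<; tri≈; tri>)
open import Relation.Binary.PropositionalEquality
open import Relation.Nullary using (¬_; Dec; yes; no; contradiction)
open import Relation.Nullary.Decidable using (⌊_⌋; toWitness; fromWitness; _×-dec_; _⊎-dec_)
open import Defs

private module ℕΣ = Algebra.Properties.CommutativeMonoid.Sum +-0-commutativeMonoid

-- Colourings without large monochromatic cliques

Clause : Set
Clause = List ℕ × Bool

Avoids : (ℕ → Bool) → Clause → Set
Avoids f (l , c) = ¬ All (λ x → f x ≡ c) l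

-- The largest variable comes first, so deciding `n` can only affect the head of a list.
DecreasingBelow : ℕ → List ℕ → Set
DecreasingBelow n l = AllPairs _>_ l × All (_< n) l

-- For l decreasing below n: the number of f : {0, …, n-1} → Bool that take a
-- given constant value on l.
weight : ℕ → List ℕ → ℕ
weight zero    _       = 1
weight (suc n) []      = 2 * weight n []
weight (suc n) (x ∷ l) with x ≟ n
... | yes _ = weight n l
... | no  _ = 2 * weight n (x ∷ l)

totalWeight : ℕ → List Clause → ℕ
totalWeight n = sum ∘ map (weight n ∘ proj₁)

-- What remains of the clauses once f n = b has been decided.
restrict : ℕ → Bool → List Clause → List Clause
restrict n b [] = []
restrict n b (([] , c) ∷ cs) = ([] , c) ∷ restrict n b cs
restrict n b ((x ∷ l , c) ∷ cs) with x ≟ n | c Bool.≟ b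
... | no  _ | _     = (x ∷ l , c) ∷ restrict n b cs
... | yes _ | yes _ = (l , c) ∷ restrict n b cs
... | yes _ | no  _ = restrict n b cs

decreasingBelow-≢ : ∀ {n x l} → x ≢ n → DecreasingBelow (suc n) (x ∷ l) →
                    DecreasingBelow n (x ∷ l)
decreasingBelow-≢ x≢n (x>l ∷ l↓ , x<1+n ∷ _) = x>l ∷ l↓ , x<n ∷ All.map (λ y<x → <-trans y<x x<n) x>l
  where x<n = ≤∧≢⇒< (s≤s⁻¹ x<1+n) x≢n

restrict-decreasing : ∀ n b cs → All (DecreasingBelow (suc n) ∘ proj₁) cs →
                      All (DecreasingBelow n ∘ proj₁) (restrict n b cs)
restrict-decreasing n b [] [] = []
restrict-decreasing n b (([] , c) ∷ cs) (_ ∷ v) = ([] , []) ∷ restrict-decreasing n b cs v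
restrict-decreasing n b ((x ∷ l , c) ∷ cs) (w@(x>l ∷ l↓ , _) ∷ v) with x ≟ n | c Bool.≟ b
... | no x≢n   | _     = decreasingBelow-≢ x≢n w ∷ restrict-decreasing n b cs v
... | yes refl | yes _ = (l↓ , x>l) ∷ restrict-decreasing n b cs v
... | yes _    | no  _ = restrict-decreasing n b cs v

double-+ : ∀ w a b → (w + a) + (w + b) ≡ 2 * w + (a + b)
double-+ = solve-∀

-- Functions are sorted by their value at `n`. A clause starting with `n` survives only in the
-- branch of its own colour, with unchanged weight; any other clause survives in both branches,
-- which matches the doubling in `weight`.
totalWeight-restrict : ∀ n cs →
  totalWeight n (restrict n true cs) + totalWeight n (restrict n false cs) ≡ totalWeight (suc n) cs
totalWeight-restrict n [] = refl
totalWeight-restrict n (([] , c) ∷ cs) rewrite sym (totalWeight-restrict n cs) =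
  double-+ (weight n []) (totalWeight n (restrict n true cs)) (totalWeight n (restrict n false cs))
totalWeight-restrict n ((x ∷ l , c) ∷ cs) with x ≟ n | c
... | no _  | true  rewrite sym (totalWeight-restrict n cs) =
  double-+ (weight n (x ∷ l)) (totalWeight n (restrict n true cs)) (totalWeight n (restrict n false cs))
... | no _  | false rewrite sym (totalWeight-restrict n cs) =
  double-+ (weight n (x ∷ l)) (totalWeight n (restrict n true cs)) (totalWeight n (restrict n false cs))
... | yes _ | true  rewrite sym (totalWeight-restrict n cs) =
  +-assoc (weight n l) (totalWeight n (restrict n true cs)) (totalWeight n (restrict n false cs))
... | yes _ | false rewrite sym (totalWeight-restrict n cs) =
  swap (weight n l) (totalWeight n (restrict n true cs)) (totalWeight n (restrict n false cs))
  where
  swap : ∀ w a b → a + (w + b) ≡ w + (a + b)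
  swap = solve-∀

_[_≔_] : (ℕ → Bool) → ℕ → Bool → ℕ → Bool
(f [ n ≔ b ]) x = if ⌊ x ≟ n ⌋ then b else f x

update-≡ : ∀ f n b → (f [ n ≔ b ]) n ≡ b
update-≡ f n b with n ≟ n
... | yes _  = refl
... | no n≢n = contradiction refl n≢n

update-< : ∀ f {n} b {x} → x < n → (f [ n ≔ b ]) x ≡ f x
update-< f {n} b {x} x<n with x ≟ n
... | yes x≡n = contradiction x≡n (<⇒≢ x<n)
... | no _    = refl

avoids-restrict : ∀ {n b} f cs → All (DecreasingBelow (suc n) ∘ proj₁) cs →
                  All (Avoids f) (restrict n b cs) → All (Avoids (f [ n ≔ b ])) cs
avoids-restrict f [] [] [] = []
avoids-restrict f (([] , c) ∷ cs) (_ ∷ v) (p ∷ ps) = (λ _ → p []) ∷ avoids-restrict f cs v ps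
avoids-restrict {n} {b} f ((x ∷ l , c) ∷ cs) (w@(x>l ∷ _ , _) ∷ v) p
  with x ≟ n | c Bool.≟ b | p
... | no x≢n   | _      | q ∷ qs = (q ∘ below (proj₂ (decreasingBelow-≢ x≢n w))) ∷ avoids-restrict f cs v qs
  where
  below : ∀ {l} → All (_< n) l → All (λ y → (f [ n ≔ b ]) y ≡ c) l → All (λ y → f y ≡ c) l
  below l<n = All.zipWith (λ (y<n , e) → trans (sym (update-< f b y<n)) e) ∘ (l<n ,_)
... | yes refl | yes _  | q ∷ qs =
  (λ { (_ ∷ e) → q (All.zipWith (λ (y<n , e) → trans (sym (update-< f b y<n)) e) (x>l , e)) }) ∷
  avoids-restrict f cs v qs
... | yes refl | no c≢b | qs     =
  (λ { (e ∷ _) → c≢b (trans (sym e) (update-≡ f n b)) }) ∷ avoids-restrict f cs v qs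

+-<-split : ∀ {a b n} → a + b < n + n → a < n ⊎ b < n
+-<-split {a} {b} {n} a+b<2n with a <? n | b <? n
... | yes a<n | _       = inj₁ a<n
... | no _    | yes b<n = inj₂ b<n
... | no a≮n  | no b≮n  = contradiction a+b<2n (≤⇒≯ (+-mono-≤ (≮⇒≥ a≮n) (≮⇒≥ b≮n)))

-- Method of conditional expectations: decide f n so that the total weight
-- of the remaining clauses at least halves.
avoidable : ∀ n cs → All (DecreasingBelow n ∘ proj₁) cs → totalWeight n cs < 2 ^ n →
            ∃[ f ] All (Avoids f) cs
-- With no variable left every clause weighs 1, so a total below `2 ^ 0` means that no clause
-- remains.
avoidable zero    []       _ _         = (λ _ → true) , []
avoidable zero    (_ ∷ cs) _ (s≤s ())
avoidable (suc n) cs v w<2^ with +-<-split w<2^′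
  where
  w<2^′ : totalWeight n (restrict n true cs) + totalWeight n (restrict n false cs) < 2 ^ n + 2 ^ n
  w<2^′ = subst₂ _<_ (sym (totalWeight-restrict n cs)) (cong (2 ^ n +_) (+-identityʳ _)) w<2^
... | inj₁ w< with f , p ← avoidable n (restrict n true cs) (restrict-decreasing n true cs v) w< =
  f [ n ≔ true ] , avoids-restrict f cs v p
... | inj₂ w< with f , p ← avoidable n (restrict n false cs) (restrict-decreasing n false cs v) w< =
  f [ n ≔ false ] , avoids-restrict f cs v p

weight-decreasing : ∀ n l → DecreasingBelow n l → weight n l * 2 ^ length l ≡ 2 ^ n
weight-decreasing zero    []      _        = refl
weight-decreasing zero    (x ∷ l) (_ , () ∷ _)
weight-decreasing (suc n) []      _        =
  trans (*-assoc 2 (weight n []) 1) (cong (2 *_) (weight-decreasing n [] ([] , [])))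
weight-decreasing (suc n) (x ∷ l) v@(x>l ∷ l↓ , _) with x ≟ n
... | yes refl = trans (swap (weight n l) (2 ^ length l)) (cong (2 *_) (weight-decreasing n l (l↓ , x>l)))
  where
  swap : ∀ a b → a * (2 * b) ≡ 2 * (a * b)
  swap = solve-∀
... | no x≢n   = trans (*-assoc 2 (weight n (x ∷ l)) _)
                       (cong (2 *_) (weight-decreasing n (x ∷ l) (decreasingBelow-≢ x≢n v)))

totalWeight-uniform : ∀ {n e} cs → All (DecreasingBelow n ∘ proj₁) cs → All ((_≡ e) ∘ length ∘ proj₁) cs →
                      totalWeight n cs * 2 ^ e ≡ length cs * 2 ^ n
totalWeight-uniform [] [] [] = refl
totalWeight-uniform {n} {e} ((l , _) ∷ cs) (v ∷ vs) (refl ∷ es) =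
  trans (*-distribʳ-+ (2 ^ e) (weight n l) (totalWeight n cs))
        (cong₂ _+_ (weight-decreasing n l v) (totalWeight-uniform cs vs es))

-- Cliques as clauses, and the union bound

subsets : ℕ → ℕ → List (List ℕ)
subsets n       zero    = [] ∷ []
subsets zero    (suc k) = []
subsets (suc n) (suc k) = map (n ∷_) (subsets n k) ++ subsets n (suc k)

subsets-complete : ∀ n l → DecreasingBelow n l → l ∈ subsets n (length l)
subsets-complete n       []      _ = here refl
subsets-complete zero    (x ∷ l) (_ , () ∷ _)
subsets-complete (suc n) (x ∷ l) v@(x>l ∷ l↓ , _) with x ≟ n
... | yes refl = ∈-++⁺ˡ (∈-map⁺ (n ∷_) (subsets-complete n l (l↓ , x>l)))
... | no x≢n   = ∈-++⁺ʳ (map (n ∷_) (subsets n (length l)))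
                        (subsets-complete n (x ∷ l) (decreasingBelow-≢ x≢n v))

subsets-sound : ∀ n k → All (λ l → DecreasingBelow n l × length l ≡ k) (subsets n k)
subsets-sound n       zero    = (([] , []) , refl) ∷ []
subsets-sound zero    (suc k) = []
subsets-sound (suc n) (suc k) = All.++⁺
  (All.map⁺ (All.map (λ { ((l↓ , l<n) , eq) →
     (l<n ∷ l↓ , n<1+n n ∷ All.map m<n⇒m<1+n l<n) , cong suc eq }) (subsets-sound n k)))
  (All.map (λ { ((l↓ , l<n) , eq) → (l↓ , All.map m<n⇒m<1+n l<n) , eq }) (subsets-sound n (suc k)))

length-subsets : ∀ n k → length (subsets n k) ≤ n ^ k
length-subsets n       zero    = ≤-refl
length-subsets zero    (suc k) = z≤n
length-subsets (suc n) (suc k) = begin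
  length (map (n ∷_) (subsets n k) ++ subsets n (suc k))
    ≡⟨ length-++ (map (n ∷_) (subsets n k)) ⟩
  length (map (n ∷_) (subsets n k)) + length (subsets n (suc k))
    ≡⟨ cong (_+ length (subsets n (suc k))) (length-map (n ∷_) (subsets n k)) ⟩
  length (subsets n k) + length (subsets n (suc k))
    ≤⟨ +-mono-≤ (length-subsets n k) (length-subsets n (suc k)) ⟩
  n ^ k + n * n ^ k
    ≤⟨ *-monoʳ-≤ (suc n) (^-monoˡ-≤ k (n≤1+n n)) ⟩
  suc n ^ suc k ∎
  where open ≤-Reasoning

-- The pair {y > x} of vertices below t is encoded as y * t + x, so that the
-- pairs of a decreasing list come out in decreasing order.
pairs : ℕ → List ℕ → List ℕ
pairs t []      = []
pairs t (y ∷ l) = map (y * t +_) l ++ pairs t l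

-- The binomial coefficient `k` choose 2: the successor case adds `k`, not `suc k`.
triangle : ℕ → ℕ
triangle zero    = 0
triangle (suc k) = k + triangle k

length-pairs : ∀ t l → length (pairs t l) ≡ triangle (length l)
length-pairs t []      = refl
length-pairs t (y ∷ l) =
  trans (length-++ (map (y * t +_) l)) (cong₂ _+_ (length-map (y * t +_) l) (length-pairs t l))

*+-mono-< : ∀ {x y z t} → x < t → y < z → y * t + x < z * t
*+-mono-< {x} {y} {z} {t} x<t y<z = begin-strict
  y * t + x <⟨ +-monoʳ-< (y * t) x<t ⟩
  y * t + t ≡⟨ +-comm (y * t) t ⟩
  suc y * t ≤⟨ *-monoˡ-≤ t y<z ⟩
  z * t     ∎
  where open ≤-Reasoning

pairs-< : ∀ {t z} l → All (_< t) l → All (_< z) l → All (_< z * t) (pairs t l)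
pairs-< []      _           _           = []
pairs-< (y ∷ l) (_ ∷ l<t) (y<z ∷ l<z) =
  All.++⁺ (All.map⁺ (All.map (λ x<t → *+-mono-< x<t y<z) l<t)) (pairs-< l l<t l<z)

pairs-decreasing : ∀ {t} l → DecreasingBelow t l → AllPairs _>_ (pairs t l)
pairs-decreasing     []      _ = []
pairs-decreasing {t} (y ∷ l) (y>l ∷ l↓ , _ ∷ l<t) = AllPairs.++⁺
  (AllPairs.map⁺ (AllPairs.map (+-monoʳ-< (y * t)) l↓))
  (pairs-decreasing l (l↓ , l<t))
  (All.map⁺ (All.universal (λ x → All.map (λ z< → <-≤-trans z< (m≤m+n _ x)) (pairs-< l l<t y>l)) l))

Clique : (ℕ → ℕ → Bool) → Bool → List ℕ → Set
Clique χ c = AllPairs (λ y x → x < y × χ y x ≡ c)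

NoClique : ℕ → ℕ → (ℕ → ℕ → Bool) → Set
NoClique t k χ = ∀ c l → length l ≡ k → All (_< t) l → ¬ Clique χ c l

clique-pairs : ∀ (f : ℕ → Bool) {c} t l → Clique (λ y x → f (y * t + x)) c l → All (λ z → f z ≡ c) (pairs t l)
clique-pairs f t []      []       = []
clique-pairs f t (y ∷ l) (p ∷ ps) = All.++⁺ (All.map⁺ (All.map proj₂ p)) (clique-pairs f t l ps)

-- Union bound over the sets of `k` points and both colours: there are at most `2 * t ^ k` clauses,
-- each on `triangle k` variables and hence violated by one function in `2 ^ triangle k`. The
-- hypothesis puts the expected number of violated clauses below 1.
noClique-exists : ∀ t k → 2 * t ^ k < 2 ^ triangle k → ∃[ χ ] NoClique t k χ
noClique-exists t k few =
  let f , avoids = avoidable (t * t) clauses decreasing light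
  in (λ y x → f (y * t + x)) , noClique f avoids
  where
  clausesOf : Bool → List Clause
  clausesOf c = map (λ l → pairs t l , c) (subsets t k)
  clauses = clausesOf true ++ clausesOf false

  decreasingOf : ∀ c → All (DecreasingBelow (t * t) ∘ proj₁) (clausesOf c)
  decreasingOf c = All.map⁺ (All.map
    (λ { {l} (v , _) → pairs-decreasing l v , pairs-< l (proj₂ v) (proj₂ v) }) (subsets-sound t k))
  decreasing = All.++⁺ (decreasingOf true) (decreasingOf false)

  uniformOf : ∀ c → All ((_≡ triangle k) ∘ length ∘ proj₁) (clausesOf c)
  uniformOf c = All.map⁺ (All.map
    (λ { {l} (_ , eq) → trans (length-pairs t l) (cong triangle eq) }) (subsets-sound t k))

  length-clausesOf : ∀ c → length (clausesOf c) ≤ t ^ k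
  length-clausesOf c = ≤-trans (≤-reflexive (length-map _ (subsets t k))) (length-subsets t k)

  light : totalWeight (t * t) clauses < 2 ^ (t * t)
  light = *-cancelʳ-< (2 ^ triangle k) (totalWeight (t * t) clauses) (2 ^ (t * t)) (begin-strict
    totalWeight (t * t) clauses * 2 ^ triangle k
      ≡⟨ totalWeight-uniform clauses decreasing (All.++⁺ (uniformOf true) (uniformOf false)) ⟩
    length clauses * 2 ^ (t * t)
      ≡⟨ cong (_* 2 ^ (t * t)) (length-++ (clausesOf true)) ⟩
    (length (clausesOf true) + length (clausesOf false)) * 2 ^ (t * t)
      ≤⟨ *-monoˡ-≤ (2 ^ (t * t)) (+-mono-≤ (length-clausesOf true) (length-clausesOf false)) ⟩
    (t ^ k + t ^ k) * 2 ^ (t * t)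
      ≡⟨ cong (λ z → (t ^ k + z) * 2 ^ (t * t)) (+-identityʳ (t ^ k)) ⟨
    (2 * t ^ k) * 2 ^ (t * t)
      <⟨ *-monoˡ-< (2 ^ (t * t)) {{m^n≢0 2 (t * t)}} few ⟩
    2 ^ triangle k * 2 ^ (t * t)
      ≡⟨ *-comm (2 ^ triangle k) (2 ^ (t * t)) ⟩
    2 ^ (t * t) * 2 ^ triangle k ∎)
    where open ≤-Reasoning

  clause∈ : ∀ c {l} → l ∈ subsets t k → (pairs t l , c) ∈ clauses
  clause∈ true  l∈ = ∈-++⁺ˡ (∈-map⁺ _ l∈)
  clause∈ false l∈ = ∈-++⁺ʳ (clausesOf true) (∈-map⁺ _ l∈)

  noClique : ∀ f → All (Avoids f) clauses → NoClique t k (λ y x → f (y * t + x))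
  noClique f avoids c l refl l<t clique =
    All.lookup avoids (clause∈ c (subsets-complete t l (AllPairs.map proj₁ clique , l<t)))
      (clique-pairs f t l clique)

-- The formula `m * (2 * m - 1)` for `2 * m` choose 2, rearranged to avoid subtraction.
triangle-even : ∀ m → triangle (2 * m) + m ≡ 2 * m * m
triangle-even zero    = refl
triangle-even (suc m) rewrite +-suc m (m + 0) = begin
  suc (2 * m) + (2 * m + triangle (2 * m)) + suc m ≡⟨ lhs m (triangle (2 * m)) ⟩
  2 + 4 * m + (triangle (2 * m) + m)               ≡⟨ cong (2 + 4 * m +_) (triangle-even m) ⟩
  2 + 4 * m + 2 * m * m                            ≡⟨ rhs m ⟩
  suc (suc (2 * m)) * suc m                        ∎
  where
  open ≡-Reasoning
  lhs : ∀ m x → suc (2 * m) + (2 * m + x) + suc m ≡ 2 + 4 * m + (x + m)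
  lhs = solve-∀
  rhs : ∀ m → 2 + 4 * m + 2 * m * m ≡ suc (suc (2 * m)) * suc m
  rhs = solve-∀

-- Erdős' lower bound for the diagonal Ramsey numbers.
noClique-2^ : ∀ τ → 1 ≤ τ → ∃[ χ ] NoClique (2 ^ τ) (2 * suc τ) χ
noClique-2^ τ 1≤τ = noClique-exists (2 ^ τ) (2 * suc τ) (begin-strict
  2 * (2 ^ τ) ^ (2 * suc τ)  ≡⟨ cong (2 *_) (^-*-assoc 2 τ (2 * suc τ)) ⟩
  2 ^ suc (τ * (2 * suc τ))  <⟨ ^-monoʳ-< 2 (s≤s (s≤s z≤n)) exponent ⟩
  2 ^ triangle (2 * suc τ)   ∎)
  where
  open ≤-Reasoning
  rearrange : ∀ τ → τ * (2 * suc τ) + suc τ + suc τ ≡ 2 * suc τ * suc τ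
  rearrange = solve-∀
  -- The two sides are `2τ² + 2τ + 1` and `2τ² + 3τ + 1`; the gap is `τ`, so `1 ≤ τ` gives
  -- strictness.
  exponent : suc (τ * (2 * suc τ)) < triangle (2 * suc τ)
  exponent = +-cancelʳ-< (suc τ) _ _ (begin-strict
    suc (τ * (2 * suc τ)) + suc τ      ≡⟨ cong (_+ suc τ) (+-comm 1 (τ * (2 * suc τ))) ⟩
    τ * (2 * suc τ) + 1 + suc τ        <⟨ +-monoˡ-< (suc τ) (+-monoʳ-< (τ * (2 * suc τ)) (s≤s 1≤τ)) ⟩
    τ * (2 * suc τ) + suc τ + suc τ    ≡⟨ rearrange τ ⟩
    2 * suc τ * suc τ                  ≡⟨ triangle-even (suc τ) ⟨
    triangle (2 * suc τ) + suc τ       ∎)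

-- Lexicographic colourings

-- Meant for `x < y`; the arguments of `χ` are swapped because cliques are listed in decreasing
-- order. The value at depth 0 is arbitrary, since `t ^ 0 = 1` point forms no pair.
lexColouring : (t : ℕ) .{{_ : NonZero t}} → (ℕ → ℕ → Bool) → ℕ → ℕ → ℕ → Bool
lexColouring t χ zero    x y = true
lexColouring t χ (suc d) x y = if ⌊ x / t ^ d ≟ y / t ^ d ⌋
  then lexColouring t χ d (x % t ^ d) (y % t ^ d)
  else χ (y / t ^ d) (x / t ^ d)
  where instance _ = m^n≢0 t d

-- The positions below q * q form q cells of length q; position j of cell i is
-- matched with position i of cell j.  An embedding places w consecutive cells,
-- starting with cell a, increasingly into {0, …, N-1}.
record Embedding (q w N : ℕ) (colour : ℕ → ℕ → Bool) (φ : ℕ → ℕ) (κ : Bool) (a : ℕ) : Set where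
  field
    fits       : a + w ≤ q
    increasing : ∀ {x y} → a * q ≤ x → x < y → y < (a + w) * q → φ x < φ y
    bounded    : ∀ {x} → a * q ≤ x → x < (a + w) * q → φ x < N
    mono       : ∀ {i j} → a ≤ i → i < j → j < a + w → colour (φ (i * q + j)) (φ (j * q + i)) ≡ κ

Unembeddable : (q w N : ℕ) → (ℕ → ℕ → Bool) → Set
Unembeddable q w N colour = ∀ {φ κ a} → ¬ Embedding q w N colour φ κ a

-- One cell already has two positions, which cannot go increasingly into a single point.
unembeddable-1 : ∀ {q colour} → 2 ≤ q → Unembeddable q 1 1 colour
unembeddable-1 {q} 2≤q {φ} {κ} {a} emb = contradiction (increasing ≤-refl x<y y<) (≤⇒≯ φy≤φx)
  where
  open Embedding emb
  x<y : a * q < suc (a * q)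
  x<y = n<1+n (a * q)
  y< : suc (a * q) < (a + 1) * q
  y< = begin-strict
    suc (a * q)   ≡⟨ +-comm 1 (a * q) ⟩
    a * q + 1     <⟨ +-monoʳ-< (a * q) 2≤q ⟩
    a * q + q     ≡⟨ +-comm (a * q) q ⟩
    suc a * q     ≡⟨ cong (_* q) (+-comm 1 a) ⟩
    (a + 1) * q   ∎
    where open ≤-Reasoning
  φy≤φx : φ (suc (a * q)) ≤ φ (a * q)
  φy≤φx = ≤-trans (s≤s⁻¹ (bounded (<⇒≤ x<y) y<)) z≤n

module Step {t : ℕ} .{{_ : NonZero t}} {χ : ℕ → ℕ → Bool} {K : ℕ} (noClique : NoClique t (suc K) χ)
            {q d W : ℕ} (2≤q : 2 ≤ q) (ih : Unembeddable q (suc W) (t ^ d) (lexColouring t χ d))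
            {φ : ℕ → ℕ} {κ : Bool} {a : ℕ}
            (emb : Embedding q (K * W + t) (t ^ suc d) (lexColouring t χ (suc d)) φ κ a) where

  open Embedding emb
  open ≤-Reasoning

  private
    S = t ^ d
    w = K * W + t
    instance
      S≢0 : NonZero S
      S≢0 = m^n≢0 t d

  -- Blocks never decrease along the cells, so cell `i` lies in one block (is whole) exactly when
  -- `first i ≡ last i`; otherwise it is broken.
  block first last : ℕ → ℕ
  block x = φ x / S
  first i = block (i * q)
  last  i = block (i * q + pred q)

  pred-q<q : pred q < q
  pred-q<q = ≤-reflexive (suc-pred q {{>-nonZero (<-trans z<s 2≤q)}})

  cell-≥ : ∀ {i} j → a ≤ i → a * q ≤ i * q + j
  cell-≥ {i} j a≤i = ≤-trans (*-monoˡ-≤ q a≤i) (m≤m+n (i * q) j)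

  block-mono : ∀ {x y} → a * q ≤ x → x ≤ y → y < (a + w) * q → block x ≤ block y
  block-mono {x} {y} a≤x x≤y y< with x ≟ y
  ... | yes refl = ≤-refl
  ... | no x≢y   = /-monoˡ-≤ S (<⇒≤ (increasing a≤x (≤∧≢⇒< x≤y x≢y) y<))

  block<t : ∀ {x} → a * q ≤ x → x < (a + w) * q → block x < t
  block<t a≤x x< = m<n*o⇒m/o<n (bounded a≤x x<)

  first≤block : ∀ {i j} → a ≤ i → i < a + w → j < q → first i ≤ block (i * q + j)
  first≤block {i} {j} a≤i i<a+w j<q =
    block-mono (*-monoˡ-≤ q a≤i) (m≤m+n (i * q) j) (*+-mono-< j<q i<a+w)

  block≤last : ∀ {i j} → a ≤ i → i < a + w → j < q → block (i * q + j) ≤ last i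
  block≤last {i} {j} a≤i i<a+w j<q =
    block-mono (cell-≥ j a≤i) (+-monoʳ-≤ (i * q) (<⇒≤pred j<q)) (*+-mono-< pred-q<q i<a+w)

  first≤last : ∀ {i} → a ≤ i → i < a + w → first i ≤ last i
  first≤last a≤i i<a+w = first≤block a≤i i<a+w pred-q<q

  last≤first : ∀ {i j} → a ≤ i → i < j → j < a + w → last i ≤ first j
  last≤first {i} {j} a≤i i<j j<a+w = block-mono (cell-≥ (pred q) a≤i)
    (<⇒≤ (*+-mono-< pred-q<q i<j)) (*-monoˡ-< q {{>-nonZero (<-trans z<s 2≤q)}} j<a+w)

  -- By the induction hypothesis W + 1 consecutive cells are never contained in one block.
  first<last : ∀ {i} → a ≤ i → i + W < a + w → first i < last (i + W)
  first<last {i} a≤i i+W<a+w = ≤∧≢⇒< first≤last′ λ same → ih (record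
    -- If all these cells shared a block, reducing `φ` modulo `S` would embed them one level down
    -- with the same colours.
    { fits       = ≤-trans (≤-trans (≤-reflexive (+-suc i W)) i+W<a+w) fits
    ; increasing = λ {x} {y} lo x<y hi → %-increasing (trans (inBlock same lo (<-trans x<y hi))
                                                            (sym (inBlock same (≤-trans lo (<⇒≤ x<y)) hi)))
                                                     (increasing (≥start lo) x<y (<end hi))
    ; bounded    = λ _ _ → m%n<n _ S
    ; mono       = λ {j} {k} i≤j j<k k<  →
        let j<  = <-trans j<k k<
            k<q = <-≤-trans k< (≤-trans (≤-reflexive (+-suc i W)) (≤-trans i+W<a+w fits))
            i≤k = ≤-trans i≤j (<⇒≤ j<k)
            e₁  = inBlock same (cell-≥′ i≤j) (*+-mono-< k<q j<)
            e₂  = inBlock same (cell-≥′ i≤k) (*+-mono-< (<-trans j<k k<q) k<)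
        in trans (sym (sameBlock (trans e₁ (sym e₂))))
                 (mono (≤-trans a≤i i≤j) j<k (≤-trans k< (≤-trans (≤-reflexive (+-suc i W)) i+W<a+w)))
    })
    where
    first≤last′ : first i ≤ last (i + W)
    first≤last′ = block-mono (*-monoˡ-≤ q a≤i)
      (≤-trans (*-monoˡ-≤ q (m≤m+n i W)) (m≤m+n _ _)) (*+-mono-< pred-q<q i+W<a+w)

    cell-≥′ : ∀ {j l} → i ≤ j → i * q ≤ j * q + l
    cell-≥′ {j} {l} i≤j = ≤-trans (*-monoˡ-≤ q i≤j) (m≤m+n (j * q) l)

    ≥start : ∀ {x} → i * q ≤ x → a * q ≤ x
    ≥start = ≤-trans (*-monoˡ-≤ q a≤i)

    <end : ∀ {x} → x < (i + suc W) * q → x < (a + w) * q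
    <end x< = <-≤-trans x< (*-monoˡ-≤ q (≤-trans (≤-reflexive (+-suc i W)) i+W<a+w))

    ≤last : ∀ {x} → x < (i + suc W) * q → x ≤ (i + W) * q + pred q
    ≤last {x} x< = s≤s⁻¹ (begin-strict
      x                            <⟨ x< ⟩
      (i + suc W) * q              ≡⟨ cong (_* q) (+-suc i W) ⟩
      q + (i + W) * q              ≡⟨ +-comm q _ ⟩
      (i + W) * q + q              ≡⟨ cong ((i + W) * q +_) (suc-pred q {{>-nonZero (<-trans z<s 2≤q)}}) ⟨
      (i + W) * q + suc (pred q)   ≡⟨ +-suc _ (pred q) ⟩
      suc ((i + W) * q + pred q)   ∎)

    inBlock : first i ≡ last (i + W) → ∀ {x} → i * q ≤ x → x < (i + suc W) * q → block x ≡ first i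
    inBlock same lo hi = ≤-antisym
      (≤-trans (block-mono (≥start lo) (≤last hi) (*+-mono-< pred-q<q i+W<a+w)) (≤-reflexive (sym same)))
      (block-mono (*-monoˡ-≤ q a≤i) lo (<end hi))

    %-increasing : ∀ {x y} → x / S ≡ y / S → x < y → x % S < y % S
    %-increasing {x} {y} x/S≡y/S x<y = +-cancelʳ-< (x / S * S) _ _ (begin-strict
      x % S + x / S * S  ≡⟨ m≡m%n+[m/n]*n x S ⟨
      x                  <⟨ x<y ⟩
      y                  ≡⟨ m≡m%n+[m/n]*n y S ⟩
      y % S + y / S * S  ≡⟨ cong (λ z → y % S + z * S) x/S≡y/S ⟨
      y % S + x / S * S  ∎)

    sameBlock : ∀ {x y} → x / S ≡ y / S →
                lexColouring t χ (suc d) x y ≡ lexColouring t χ d (x % S) (y % S)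
    sameBlock {x} {y} eq with x / S ≟ y / S
    ... | yes _ = refl
    ... | no ne = contradiction eq ne

  distinctBlocks : ∀ {x y} → x / S ≢ y / S → lexColouring t χ (suc d) x y ≡ χ (y / S) (x / S)
  distinctBlocks {x} {y} ne with x / S ≟ y / S
  ... | yes eq = contradiction eq ne
  ... | no _   = refl

  -- The comparison is with `last i`, not `first i`, because `first<last` yields no more: the cell
  -- reached after a skip may start in the block of `j` and be broken. Once `i` is whole, the two
  -- comparisons agree.
  WholeBefore : ℕ → ℕ → Set
  WholeBefore i j = a ≤ j × j < a + w × first j ≡ last j × last j < last i

  whole-< : ∀ {i j} → a ≤ i → i < a + w → WholeBefore i j → j < i
  whole-< {i} {j} a≤i i<a+w (a≤j , j<a+w , fj≡lj , lj<li) = ≰⇒> λ i≤j →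
    <⇒≱ lj<li (block-mono (cell-≥ (pred q) a≤i)
      (+-monoˡ-≤ (pred q) (*-monoˡ-≤ q i≤j)) (*+-mono-< pred-q<q j<a+w))

  whole-block : ∀ {j k} → a ≤ j → j < a + w → first j ≡ last j → k < q → block (j * q + k) ≡ first j
  whole-block a≤j j< fj≡lj k<q = ≤-antisym
    (≤-trans (block≤last a≤j j< k<q) (≤-reflexive (sym fj≡lj))) (first≤block a≤j j< k<q)

  -- The matching edge between two whole cells in different blocks crosses between these blocks, so
  -- its colour is the one `χ` gives to the pair of blocks.
  whole-edge : ∀ {i j} → a ≤ i → i < a + w → first i ≡ last i → WholeBefore i j →
               first j < first i × χ (first i) (first j) ≡ κ
  whole-edge {i} {j} a≤i i< fi≡li wj@(a≤j , j< , fj≡lj , lj<li) = fj<fi , trans (sym colour) (mono a≤j j<i i<)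
    where
    j<i = whole-< a≤i i< wj
    fj<fi : first j < first i
    fj<fi = subst₂ _<_ (sym fj≡lj) (sym fi≡li) lj<li
    bj = whole-block a≤j j< fj≡lj (<-≤-trans i< fits)
    bi = whole-block a≤i i< fi≡li (<-≤-trans j< fits)
    colour : lexColouring t χ (suc d) (φ (j * q + i)) (φ (i * q + j)) ≡ χ (first i) (first j)
    colour = trans (distinctBlocks λ e → <⇒≢ fj<fi (trans (sym bj) (trans e bi))) (cong₂ χ bi bj)

  -- Walk through the cells.  Passing a broken cell moves to a later block; a
  -- whole cell extends the clique, and the next W - 1 cells are skipped.  So
  -- cell i is reached with i - a at most W times the size of the clique plus
  -- the number G of blocks left behind.
  sweep : ∀ fuel i l G → K + t ≤ fuel + length l + G → length l ≤ K → G < t →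
          a ≤ i → i ≤ a + length l * W + G →
          (i < a + w → G ≤ first i × All (WholeBefore i) l) →
          Clique χ κ (map first l) → ⊥
  -- Each unit of fuel spent raises `length l` or `G` by at least one, so the fuel cannot run out
  -- while `length l ≤ K` and `G < t`.
  sweep zero i l G enough l≤K G<t _ _ _ _ = <⇒≱ (+-mono-≤-< l≤K G<t) enough
  sweep (suc fuel) i l G enough l≤K G<t a≤i i≤ before clique = step (m≤n⇒m<n∨m≡n (first≤last a≤i i<))
    where
    inRange : ∀ {i k} → k ≤ K → i ≤ a + k * W + G → i < a + w
    inRange {i} {k} k≤K i≤ = begin-strict
      i                ≤⟨ i≤ ⟩
      a + k * W + G    <⟨ +-mono-≤-< (+-monoʳ-≤ a (*-monoˡ-≤ W k≤K)) G<t ⟩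
      a + K * W + t    ≡⟨ +-assoc a (K * W) t ⟩
      a + w            ∎
    i< = inRange l≤K i≤
    G≤ = proj₁ (before i<)
    wholes = proj₂ (before i<)

    later : ∀ k {j} → last i ≤ last k → WholeBefore i j → WholeBefore k j
    later k i≤k (a≤j , j< , fj≡lj , lj<li) = a≤j , j< , fj≡lj , <-≤-trans lj<li i≤k

    step : first i < last i ⊎ first i ≡ last i → ⊥
    -- From `G ≤ first i < last i`, replacing `G` by `last i` pays for the one cell passed.
    step (inj₁ broken) = sweep fuel (suc i) l (last i)
      (begin
        K + t                       ≤⟨ enough ⟩
        suc (fuel + length l + G)   ≡⟨ +-suc (fuel + length l) G ⟨
        fuel + length l + suc G     ≤⟨ +-monoʳ-≤ (fuel + length l) (≤-<-trans G≤ broken) ⟩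
        fuel + length l + last i    ∎)
      l≤K
      (block<t (cell-≥ (pred q) a≤i) (*+-mono-< pred-q<q i<))
      (m≤n⇒m≤1+n a≤i)
      (begin-strict
        i                           ≤⟨ i≤ ⟩
        a + length l * W + G        <⟨ +-monoʳ-< (a + length l * W) (≤-<-trans G≤ broken) ⟩
        a + length l * W + last i   ∎)
      (λ 1+i< → let li≤f = last≤first {i} {suc i} a≤i (n<1+n i) 1+i< in
         li≤f , All.map (later (suc i) (≤-trans li≤f (first≤last {suc i} (m≤n⇒m≤1+n a≤i) 1+i<))) wholes)
      clique
    step (inj₂ whole) = grow (suc (length l) ≤? K)
      where
      clique′ : Clique χ κ (map first (i ∷ l))
      clique′ = All.map⁺ (All.map (whole-edge {i} a≤i i< whole) wholes) ∷ clique

      blocks<t : All (_< t) (map first (i ∷ l))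
      blocks<t = All.map⁺ {xs = i ∷ l} (first<t {i} a≤i i< ∷ All.map (λ {j} (a≤j , j< , _) → first<t {j} a≤j j<) wholes)
        where
        first<t : ∀ {j} → a ≤ j → j < a + w → first j < t
        first<t a≤j j< = block<t (*-monoˡ-≤ q a≤j) (*-monoˡ-< q {{>-nonZero (<-trans z<s 2≤q)}} j<)

      grow : Dec (suc (length l) ≤ K) → ⊥
      grow (no  K≤l) = noClique κ (map first (i ∷ l))
        (trans (length-map first (i ∷ l)) (cong suc (≤-antisym l≤K (s≤s⁻¹ (≰⇒> K≤l))))) blocks<t clique′
      grow (yes l<K) = sweep fuel (i + W) (i ∷ l) G
        (≤-trans enough (≤-reflexive (cong (_+ G) (sym (+-suc fuel (length l))))))
        l<K G<t (≤-trans a≤i (m≤m+n i W))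
        i+W≤
        -- Skipping ahead by `W` is what lets `first<last` put cell `i` strictly before the end of
        -- the cell reached.
        (λ i+W< → ≤-trans G≤ (first-mono i+W<) ,
                  (a≤i , i< , whole , subst (_< last (i + W)) whole (first<last {i} a≤i i+W<)) ∷
                  All.map (later (i + W) (last-mono i+W<)) wholes)
        clique′
        where
        i+W≤ : i + W ≤ a + suc (length l) * W + G
        i+W≤ = begin
          i + W                        ≤⟨ +-monoˡ-≤ W i≤ ⟩
          a + length l * W + G + W     ≡⟨ rearrange a (length l * W) G W ⟩
          a + suc (length l) * W + G   ∎
          where
          rearrange : ∀ a x g w → a + x + g + w ≡ a + (w + x) + g
          rearrange = solve-∀
        first-mono : i + W < a + w → first i ≤ first (i + W)
        first-mono i+W< = block-mono (*-monoˡ-≤ q a≤i) (*-monoˡ-≤ q (m≤m+n i W))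
          (*-monoˡ-< q {{>-nonZero (<-trans z<s 2≤q)}} i+W<)
        last-mono : i + W < a + w → last i ≤ last (i + W)
        last-mono i+W< = block-mono (cell-≥ (pred q) a≤i)
          (+-monoˡ-≤ (pred q) (*-monoˡ-≤ q (m≤m+n i W))) (*+-mono-< pred-q<q i+W<)

  impossible : ⊥
  impossible = sweep (K + t) a [] 0
    (≤-reflexive (sym (trans (+-identityʳ _) (+-identityʳ _)))) z≤n (>-nonZero⁻¹ t) ≤-refl
    (≤-reflexive (sym (trans (+-identityʳ _) (+-identityʳ _)))) (λ _ → z≤n , []) []

unembeddable-suc : ∀ {t} .{{_ : NonZero t}} {χ K q d W} → NoClique t (suc K) χ → 2 ≤ q →
  Unembeddable q (suc W) (t ^ d) (lexColouring t χ d) →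
  Unembeddable q (K * W + t) (t ^ suc d) (lexColouring t χ (suc d))
unembeddable-suc {d = d} {W} noClique 2≤q ih emb = Step.impossible noClique {d = d} {W} 2≤q ih emb

-- The number of cells that cannot be placed into {0, …, t^d - 1}.
cells : ℕ → ℕ → ℕ → ℕ
cells t K zero    = 1
cells t K (suc d) = K * pred (cells t K d) + t

cells>0 : ∀ t .{{_ : NonZero t}} K d → 0 < cells t K d
cells>0 t K zero    = z<s
cells>0 t K (suc d) = ≤-trans (>-nonZero⁻¹ t) (m≤n+m t (K * pred (cells t K d)))

unembeddable : ∀ {t} .{{_ : NonZero t}} {χ K q} → NoClique t (suc K) χ → 2 ≤ q → ∀ d →
  Unembeddable q (cells t K d) (t ^ d) (lexColouring t χ d)
unembeddable             noClique 2≤q zero    = unembeddable-1 2≤q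
unembeddable {t} {χ} {K} {q} noClique 2≤q (suc d) = unembeddable-suc {d = d} noClique 2≤q
  (subst (λ w → Unembeddable q w (t ^ d) (lexColouring t χ d))
    (sym (suc-pred (cells t K d) {{>-nonZero (cells>0 t K d)}})) (unembeddable noClique 2≤q d))

-- After `pred` is dropped, the summand `t` is at most `t * suc K ^ d`, so each further level costs
-- at most a factor `suc K`.
cells-≤ : ∀ t K d → cells t K (suc d) ≤ t * suc K ^ d
cells-≤ t K zero    = ≤-reflexive (trans (cong (_+ t) (*-zeroʳ K)) (sym (*-identityʳ t)))
cells-≤ t K (suc d) = begin
  K * pred (cells t K (suc d)) + t        ≤⟨ +-monoˡ-≤ t (*-monoʳ-≤ K (pred[n]≤n {cells t K (suc d)})) ⟩
  K * cells t K (suc d) + t               ≤⟨ +-mono-≤ (*-monoʳ-≤ K (cells-≤ t K d)) (m≤m*n t (suc K ^ d) {{m^n≢0 (suc K) d}}) ⟩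
  K * (t * suc K ^ d) + t * suc K ^ d     ≡⟨ rearrange K t (suc K ^ d) ⟩
  t * (suc K * suc K ^ d)                 ∎
  where
  open ≤-Reasoning
  rearrange : ∀ K t x → K * (t * x) + t * x ≡ t * (suc K * x)
  rearrange = solve-∀

-- Degrees, paths and tournaments

bit : Bool → ℕ
bit b = if b then 1 else 0

∣tabulate∣ : ∀ {n} (f : Fin n → Bool) → ∣ tabulate f ∣ ≡ ℕΣ.sum (bit ∘ f)
∣tabulate∣ {zero}  f = refl
∣tabulate∣ {suc n} f with f Fin.zero
... | true  = cong suc (∣tabulate∣ (f ∘ Fin.suc))
... | false = ∣tabulate∣ (f ∘ Fin.suc)

sum-mono : ∀ {n} {f g : Fin n → ℕ} → (∀ i → f i ≤ g i) → ℕΣ.sum f ≤ ℕΣ.sum g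
sum-mono {zero}  f≤g = z≤n
sum-mono {suc n} f≤g = +-mono-≤ (f≤g Fin.zero) (sum-mono (f≤g ∘ Fin.suc))

δ : ℕ → ℕ → ℕ
δ x y = bit (y ≡ᵇ x)

δ-refl : ∀ x → δ x x ≡ 1
δ-refl zero    = refl
δ-refl (suc x) = δ-refl x

sum-δ≤1 : ∀ n x → ℕΣ.sum {n} (δ x ∘ toℕ) ≤ 1
sum-δ≤1 zero    x       = z≤n
sum-δ≤1 (suc n) zero    = s≤s (≤-reflexive (ℕΣ.sum-replicate-zero n))
sum-δ≤1 (suc n) (suc x) = sum-δ≤1 n x

sum-δ≥1 : ∀ {n x} → x < n → 1 ≤ ℕΣ.sum {n} (δ x ∘ toℕ)
sum-δ≥1 {suc n} {zero}  _         = s≤s z≤n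
sum-δ≥1 {suc n} {suc x} (s≤s x<n) = sum-δ≥1 x<n

sum-δ₃ : ∀ n x y z → ℕΣ.sum {n} (λ w → δ x (toℕ w) + δ y (toℕ w) + δ z (toℕ w)) ≡
         ℕΣ.sum {n} (δ x ∘ toℕ) + ℕΣ.sum {n} (δ y ∘ toℕ) + ℕΣ.sum {n} (δ z ∘ toℕ)
sum-δ₃ n x y z = trans (ℕΣ.∑-distrib-+ {n} (λ w → δ x (toℕ w) + δ y (toℕ w)) (δ z ∘ toℕ))
  (cong (_+ ℕΣ.sum {n} (δ z ∘ toℕ)) (ℕΣ.∑-distrib-+ {n} (δ x ∘ toℕ) (δ y ∘ toℕ)))

module _ {n} (G : Digraph n) where

  degree-sum : ∀ v → degree G v ≡ ℕΣ.sum (λ w → bit (adj G v w) + bit (adj G w v))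
  degree-sum v = trans (cong₂ _+_ (∣tabulate∣ (adj G v)) (∣tabulate∣ (λ w → adj G w v)))
    (sym (ℕΣ.∑-distrib-+ (bit ∘ adj G v) (λ w → bit (adj G w v))))

  -- Asymmetry makes each neighbour count once. The numbers `x`, `y`, `z` may coincide, exceed the
  -- range or name a non-neighbour, as happens at the ends of a path.
  degree≤3 : ∀ v (x y z : ℕ) → (∀ {w} → G [ v ⟶ w ] ⊎ G [ w ⟶ v ] → toℕ w ≡ x ⊎ toℕ w ≡ y ⊎ toℕ w ≡ z) →
             degree G v ≤ 3
  degree≤3 v x y z neighbour = begin
    degree G v                                                 ≡⟨ degree-sum v ⟩
    ℕΣ.sum (λ w → bit (adj G v w) + bit (adj G w v))           ≤⟨ sum-mono pointwise ⟩
    ℕΣ.sum {n} (λ w → δ x (toℕ w) + δ y (toℕ w) + δ z (toℕ w)) ≡⟨ sum-δ₃ n x y z ⟩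
    ℕΣ.sum {n} (δ x ∘ toℕ) + ℕΣ.sum {n} (δ y ∘ toℕ) + ℕΣ.sum {n} (δ z ∘ toℕ)
      ≤⟨ +-mono-≤ (+-mono-≤ (sum-δ≤1 n x) (sum-δ≤1 n y)) (sum-δ≤1 n z) ⟩
    3 ∎
    where
    open ≤-Reasoning
    hit : ∀ {u} → u ≡ x ⊎ u ≡ y ⊎ u ≡ z → 1 ≤ δ x u + δ y u + δ z u
    hit {u} (inj₁ refl)        rewrite δ-refl u = s≤s z≤n
    hit {u} (inj₂ (inj₁ refl)) rewrite δ-refl u = ≤-trans (m≤n+m 1 (δ x u)) (m≤m+n (δ x u + 1) _)
    hit {u} (inj₂ (inj₂ refl)) rewrite δ-refl u = m≤n+m 1 (δ x u + δ y u)
    pointwise : ∀ w → bit (adj G v w) + bit (adj G w v) ≤ δ x (toℕ w) + δ y (toℕ w) + δ z (toℕ w)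
    pointwise w with adj G v w in vw | adj G w v in wv
    ... | true  | true  = contradiction (subst T (sym wv) _) (asym G (subst T (sym vw) _))
    ... | true  | false = hit (neighbour (inj₁ (subst T (sym vw) _)))
    ... | false | true  = hit (neighbour (inj₂ (subst T (sym wv) _)))
    ... | false | false = z≤n

  degree≥3 : ∀ v {x y z} → x < y → y < z → z < n →
             (∀ w → toℕ w ≡ x ⊎ toℕ w ≡ y ⊎ toℕ w ≡ z → G [ v ⟶ w ] ⊎ G [ w ⟶ v ]) →
             3 ≤ degree G v
  degree≥3 v {x} {y} {z} x<y y<z z<n neighbour = begin
    3 ≤⟨ +-mono-≤ (+-mono-≤ (sum-δ≥1 (<-trans x<y (<-trans y<z z<n))) (sum-δ≥1 (<-trans y<z z<n))) (sum-δ≥1 z<n) ⟩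
    ℕΣ.sum {n} (δ x ∘ toℕ) + ℕΣ.sum {n} (δ y ∘ toℕ) + ℕΣ.sum {n} (δ z ∘ toℕ)
      ≡⟨ sum-δ₃ n x y z ⟨
    ℕΣ.sum {n} (λ w → δ x (toℕ w) + δ y (toℕ w) + δ z (toℕ w)) ≤⟨ sum-mono pointwise ⟩
    ℕΣ.sum (λ w → bit (adj G v w) + bit (adj G w v))           ≡⟨ degree-sum v ⟨
    degree G v                                                 ∎
    where
    open ≤-Reasoning
    hit : ∀ {w} → G [ v ⟶ w ] ⊎ G [ w ⟶ v ] → 1 ≤ bit (adj G v w) + bit (adj G w v)
    hit {w} (inj₁ e) with true ← adj G v w = s≤s z≤n
    hit {w} (inj₂ e) with true ← adj G w v = m≤n+m 1 _
    δ-≢ : ∀ {x u} → u ≢ x → δ x u ≡ 0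
    δ-≢ {x} {u} u≢x with u ≡ᵇ x in eq
    ... | true  = contradiction (≡ᵇ⇒≡ u x (subst T (sym eq) _)) u≢x
    ... | false = refl
    pointwise : ∀ w → δ x (toℕ w) + δ y (toℕ w) + δ z (toℕ w) ≤ bit (adj G v w) + bit (adj G w v)
    pointwise w with toℕ w ≟ x | toℕ w ≟ y | toℕ w ≟ z
    ... | yes e | _ | _
      rewrite e | δ-refl x | δ-≢ (<⇒≢ x<y) | δ-≢ (<⇒≢ (<-trans x<y y<z)) = hit (neighbour w (inj₁ e))
    ... | no _ | yes e | _
      rewrite e | δ-refl y | δ-≢ (≢-sym (<⇒≢ x<y)) | δ-≢ (<⇒≢ y<z) = hit (neighbour w (inj₂ (inj₁ e)))
    ... | no _ | no _ | yes e
      rewrite e | δ-refl z | δ-≢ (≢-sym (<⇒≢ (<-trans x<y y<z))) | δ-≢ (≢-sym (<⇒≢ y<z)) =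
        hit (neighbour w (inj₂ (inj₂ e)))
    ... | no x≢ | no y≢ | no z≢ rewrite δ-≢ x≢ | δ-≢ y≢ | δ-≢ z≢ = z≤n

  maxDegree≡3 : (∀ v → degree G v ≤ 3) → ∀ v → 3 ≤ degree G v → maxDegree G ≡ 3
  maxDegree≡3 ≤3 v 3≤ = ≤-antisym
    (max≤v⁺ {xs = map (degree G) (allFin n)} z≤n (All.map⁺ (All.universal ≤3 (allFin n))))
    (v≤max⁺ 0 (map (degree G) (allFin n)) (inj₂ (lose (∈-map⁺ (degree G) (∈-allFin v)) 3≤)))

  acyclic-toℕ : (∀ {u v} → G [ u ⟶ v ] → toℕ u < toℕ v) → Acyclic G
  acyclic-toℕ forward refl walk = <-irrefl refl (increases walk)
    where
    increases : ∀ {u v} → TransClosure (G [_⟶_]) u v → toℕ u < toℕ v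
    increases [ e ]    = forward e
    increases (e ∷ es) = <-trans (forward e) (increases es)

transitiveTournament : ∀ N → Digraph N
transitiveTournament N = record
  { adj  = λ u v → ⌊ toℕ u <? toℕ v ⌋
  ; asym = λ u<v v<u → <-asym (toWitness u<v) (toWitness v<u)
  }

transitiveTournament-isTournament : ∀ N → IsTournament (transitiveTournament N)
transitiveTournament-isTournament N {u} {v} u≢v with <-cmp (toℕ u) (toℕ v)
... | tri< u<v _ _ = inj₁ (fromWitness u<v)
... | tri≈ _ u≡v _ = contradiction (toℕ-injective u≡v) u≢v
... | tri> _ _ v<u = inj₂ (fromWitness v<u)

-- The Hamiltonian path with a matching

module _ (q : ℕ) .{{_ : NonZero q}} where

  transpose : ℕ → ℕ
  transpose x = x % q * q + x / q

  transpose-cell : ∀ i {j} → j < q → transpose (i * q + j) ≡ j * q + i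
  transpose-cell i {j} j<q rewrite +-comm (i * q) j = cong₂ (λ r s → r * q + s)
    (trans ([m+kn]%n≡m%n j i q) (m<n⇒m%n≡m j<q))
    (trans (+-distrib-/-∣ʳ j (divides-refl i)) (cong₂ _+_ (m<n⇒m/n≡0 j<q) (m*n/n≡m i q)))

  -- From `q * q` on, `transpose` is no longer an involution. Requiring both equations keeps the
  -- extra edges a matching: the partner of `x` can only be `transpose x`, whichever way the edge
  -- points.
  Linked : ℕ → ℕ → Set
  Linked x y = x < y × (y ≡ suc x ⊎ y ≡ transpose x × x ≡ transpose y)

  linked? : ∀ x y → Dec (Linked x y)
  linked? x y = x <? y ×-dec (y ≟ suc x ⊎-dec (y ≟ transpose x ×-dec x ≟ transpose y))

  matchedPath : ∀ n → Digraph n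
  matchedPath n = record
    { adj  = λ u v → ⌊ linked? (toℕ u) (toℕ v) ⌋
    ; asym = λ uv vu → <-asym (proj₁ (toWitness uv)) (proj₁ (toWitness vu))
    }

  module _ {n : ℕ} where

    private H = matchedPath n

    matchedPath-acyclic : Acyclic H
    matchedPath-acyclic = acyclic-toℕ H (proj₁ ∘ toWitness)

    matchedPath-degree≤3 : ∀ v → degree H v ≤ 3
    matchedPath-degree≤3 v = degree≤3 H v (suc (toℕ v)) (pred (toℕ v)) (transpose (toℕ v)) λ where
      (inj₁ vw) → Sum.map₂ (inj₂ ∘ proj₁) (proj₂ (toWitness vw))
      (inj₂ wv) → inj₂ (Sum.map (λ v≡1+w → cong pred (sym v≡1+w)) proj₂ (proj₂ (toWitness wv)))

    -- Degree 3 is attained at vertex 1, position 1 of cell 0: its path neighbours are 0 and 2, and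
    -- it is matched with `q`, position 0 of cell 1. The bound `3 ≤ q` separates 2 from `q`.
    matchedPath-maxDegree : 3 ≤ q → q < n → maxDegree H ≡ 3
    matchedPath-maxDegree 3≤q q<n = maxDegree≡3 H matchedPath-degree≤3 v
      (degree≥3 H v {0} {2} {q} z<s 3≤q q<n neighbour)
      where
      1<q : 1 < q
      1<q = <-trans (n<1+n 1) 3≤q
      1<n : 1 < n
      1<n = <-trans 1<q q<n
      v = fromℕ< 1<n
      transpose-1 : transpose 1 ≡ q
      transpose-1 = trans (transpose-cell 0 1<q) (trans (+-identityʳ (1 * q)) (*-identityˡ q))
      transpose-q : transpose q ≡ 1
      transpose-q = trans (cong transpose (sym (trans (+-identityʳ (1 * q)) (*-identityˡ q))))
        (transpose-cell 1 {0} (<-trans z<s 1<q))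
      linked : ∀ {x} → x ≡ 0 ⊎ x ≡ 2 ⊎ x ≡ q → Linked 1 x ⊎ Linked x 1
      linked (inj₁ refl)        = inj₂ (z<s , inj₁ refl)
      linked (inj₂ (inj₁ refl)) = inj₁ (n<1+n 1 , inj₁ refl)
      linked (inj₂ (inj₂ refl)) = inj₁ (1<q , inj₂ (sym transpose-1 , sym transpose-q))
      neighbour : ∀ w → toℕ w ≡ 0 ⊎ toℕ w ≡ 2 ⊎ toℕ w ≡ q → H [ v ⟶ w ] ⊎ H [ w ⟶ v ]
      neighbour w at = Sum.map
        (λ e → fromWitness (subst (λ x → Linked x (toℕ w)) (sym (toℕ-fromℕ< 1<n)) e))
        (λ e → fromWitness (subst (Linked (toℕ w)) (sym (toℕ-fromℕ< 1<n)) e))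
        (linked at)

    linked-edge : ∀ {x y} (x<n : x < n) (y<n : y < n) → Linked x y → H [ fromℕ< x<n ⟶ fromℕ< y<n ]
    linked-edge x<n y<n e = fromWitness (subst₂ Linked (sym (toℕ-fromℕ< x<n)) (sym (toℕ-fromℕ< y<n)) e)

-- From monochromatic copies to embeddings of cells

twoColours : ∀ {k} → 2 ≤ k → Bool → Fin k
twoColours (s≤s (s≤s _)) true  = Fin.zero
twoColours (s≤s (s≤s _)) false = Fin.suc Fin.zero

twoColours-injective : ∀ {k} (2≤k : 2 ≤ k) {b c} → twoColours 2≤k b ≡ twoColours 2≤k c → b ≡ c
twoColours-injective (s≤s (s≤s _)) {true}  {true}  _ = refl
twoColours-injective (s≤s (s≤s _)) {false} {false} _ = refl

-- Any tournament with any colouring will do, since a copy is injective on vertices.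
arrows⇒≥ : ∀ {n k r} {H : Digraph n} → 2 ≤ k → Arrows k H r → n ≤ r
arrows⇒≥ {r = r} 2≤k arrows
  with φ , _ ← arrows (transitiveTournament r) (transitiveTournament-isTournament r) (λ _ → twoColours 2≤k true)
  = injective⇒≤ {f = vertex φ} (injective φ)

-- Vertex maps are made total to suit `Embedding`; the default 0 is only taken outside the `n`
-- vertices, while all cells used lie below `q * q ≤ n`.
extend : ∀ {n} → (Fin n → ℕ) → ℕ → ℕ
extend {n} f x with x <? n
... | yes x<n = f (fromℕ< x<n)
... | no  _   = 0

extend-< : ∀ {n x} (f : Fin n → ℕ) (x<n : x < n) → extend f x ≡ f (fromℕ< x<n)
extend-< {n} {x} f x<n with x <? n
... | yes _  = refl
... | no x≮n = contradiction x<n x≮n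

increasing-steps : ∀ {n} {f : ℕ → ℕ} → (∀ {x} → suc x < n → f x < f (suc x)) →
                   ∀ {x y} → x < y → y < n → f x < f y
increasing-steps {f = f} step {x} {suc y} (s≤s x≤y) 1+y<n with m≤n⇒m<n∨m≡n x≤y
... | inj₁ x<y  = <-trans (increasing-steps {f = f} step x<y (<-trans (n<1+n y) 1+y<n)) (step 1+y<n)
... | inj₂ refl = step 1+y<n

-- A copy of a Hamiltonian path in a transitive tournament is increasing.
unembeddable⇒< : ∀ {n k r q w N colour} .{{_ : NonZero q}} → 2 ≤ k → 2 ≤ q → w ≤ q → q * q ≤ n →
                 Unembeddable q w N colour → Arrows k (matchedPath q n) r → N < r
unembeddable⇒< {n} {k} {r} {q} {w} {N} {colour} 2≤k 2≤q w≤q q²≤n unembeddable arrows = ≰⇒> r≰N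
  where
  G = transitiveTournament r

  colouring : EdgeColouring k G
  colouring {u} {v} _ = twoColours 2≤k (colour (toℕ u) (toℕ v))

  wq≤n : w * q ≤ n
  wq≤n = ≤-trans (*-monoˡ-≤ q w≤q) q²≤n

  r≰N : ¬ r ≤ N
  r≰N r≤N = unembeddable {φ} {κ} {0} record
    { fits       = w≤q
    ; increasing = λ _ x<y y< → increasing-steps {f = φ}
                     (λ {x} 1+x<n → edge-< (<-trans (n<1+n x) 1+x<n) 1+x<n (step x)) x<y (<-≤-trans y< wq≤n)
    ; bounded    = λ _ x< → <-≤-trans (φ<r (<-≤-trans x< wq≤n)) r≤N
    ; mono       = λ {i} {j} _ i<j j<w → let j<q = <-≤-trans j<w w≤q in
        edge-colour (<-≤-trans (*+-mono-< j<q (<-trans i<j j<q)) q²≤n)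
                    (<-≤-trans (*+-mono-< (<-trans i<j j<q) j<q) q²≤n)
                    (<-≤-trans (*+-mono-< j<q i<j) (m≤m+n (j * q) i) ,
                     inj₂ (sym (transpose-cell q i j<q) , sym (transpose-cell q j (<-trans i<j j<q))))
    }
    where
    monoCopy = arrows G (transitiveTournament-isTournament r) (λ {u} {v} → colouring {u} {v})
    copy = proj₁ monoCopy
    φ = extend (toℕ ∘ vertex copy)
    -- The path edge from 0 to 1 serves as reference: its Boolean colour stands for the common
    -- colour in `Fin k`.
    κ = colour (φ 0) (φ 1)

    step : ∀ x → Linked q x (suc x)
    step x = n<1+n x , inj₁ refl

    φ<r : ∀ {x} → x < n → φ x < r
    φ<r x<n rewrite extend-< (toℕ ∘ vertex copy) x<n = toℕ<n _

    edge-< : ∀ {x y} → x < n → y < n → Linked q x y → φ x < φ y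
    edge-< x<n y<n e rewrite extend-< (toℕ ∘ vertex copy) x<n | extend-< (toℕ ∘ vertex copy) y<n =
      toWitness (edge copy (linked-edge q x<n y<n e))

    edge-colour′ : ∀ {x y} → x < n → y < n → Linked q x y →
                   twoColours 2≤k (colour (φ x) (φ y)) ≡ proj₁ (proj₂ monoCopy)
    edge-colour′ x<n y<n e rewrite extend-< (toℕ ∘ vertex copy) x<n | extend-< (toℕ ∘ vertex copy) y<n =
      proj₂ (proj₂ monoCopy) (linked-edge q x<n y<n e)

    1<n : 1 < n
    1<n = ≤-trans (≤-trans 2≤q (m≤m*n q q)) q²≤n

    edge-colour : ∀ {x y} → x < n → y < n → Linked q x y → colour (φ x) (φ y) ≡ κ
    edge-colour x<n y<n e = twoColours-injective 2≤k
      (trans (edge-colour′ x<n y<n e) (sym (edge-colour′ (<-trans z<s 1<n) 1<n (step 0))))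

ramsey-lower-bound : ∀ {n k r q t d K χ} .{{_ : NonZero q}} .{{_ : NonZero t}} → 2 ≤ k → 2 ≤ q →
  q * q ≤ n → cells t K d ≤ q → NoClique t (suc K) χ → Arrows k (matchedPath q n) r → t ^ d < r
ramsey-lower-bound {d = d} 2≤k 2≤q q²≤n cells≤q noClique =
  unembeddable⇒< 2≤k 2≤q cells≤q q²≤n (unembeddable noClique 2≤q d)

-- Rational approximations of the exponent

fromℕ : ℕ → ℚ
fromℕ m = ℤ.+ m ℚ./ 1

toℚᵘ-fromℕ : ∀ m → toℚᵘ (fromℕ m) ℚᵘ.≃ mkℚᵘ (ℤ.+ m) 0
toℚᵘ-fromℕ m = ℚ.toℚᵘ-fromℚᵘ (mkℚᵘ (ℤ.+ m) 0)

fromℕ-* : ∀ m k → fromℕ m ℚ.* fromℕ k ≡ fromℕ (m * k)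
fromℕ-* m k = ℚ.toℚᵘ-injective (begin-equality
  toℚᵘ (fromℕ m ℚ.* fromℕ k)             ≃⟨ ℚ.toℚᵘ-homo-* (fromℕ m) (fromℕ k) ⟩
  toℚᵘ (fromℕ m) ℚᵘ.* toℚᵘ (fromℕ k)     ≃⟨ ℚᵘ.*-cong (toℚᵘ-fromℕ m) (toℚᵘ-fromℕ k) ⟩
  mkℚᵘ (ℤ.+ m) 0 ℚᵘ.* mkℚᵘ (ℤ.+ k) 0         ≡⟨ cong (λ z → mkℚᵘ z 0) (ℤ.pos-* m k) ⟨
  mkℚᵘ (ℤ.+ (m * k)) 0                     ≃⟨ toℚᵘ-fromℕ (m * k) ⟨
  toℚᵘ (fromℕ (m * k))                   ∎)
  where open ℚᵘ.≤-Reasoning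

fromℕ-^ : ∀ m k → fromℕ m ^ᵠ k ≡ fromℕ (m ^ k)
fromℕ-^ m zero    = refl
fromℕ-^ m (suc k) = trans (cong (fromℕ m ℚ.*_) (fromℕ-^ m k)) (fromℕ-* m (m ^ k))

fromℕ-cancel-≤ : ∀ {m k} → fromℕ m ℚ.≤ fromℕ k → m ≤ k
fromℕ-cancel-≤ {m} {k} m≤k = ℤ.drop‿+≤+ (subst₂ ℤ._≤_ (ℤ.*-identityʳ (ℤ.+ m)) (ℤ.*-identityʳ (ℤ.+ k))
  (ℚᵘ.drop-*≤* (ℚᵘ.≤-respʳ-≃ (toℚᵘ-fromℕ k) (ℚᵘ.≤-respˡ-≃ (toℚᵘ-fromℕ m) (ℚ.toℚᵘ-mono-≤ m≤k)))))

fromℕ-nonNeg : ∀ m → ℚ.0ℚ ℚ.≤ fromℕ m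
fromℕ-nonNeg m = ℚ.toℚᵘ-cancel-≤ (ℚᵘ.≤-respʳ-≃ (ℚᵘ.≃-sym (toℚᵘ-fromℕ m))
  (ℚᵘ.*≤* (subst (ℤ.+ 0 ℤ.≤_) (sym (ℤ.*-identityʳ (ℤ.+ m))) (ℤ.+≤+ z≤n))))

*-mono-≤-nonNeg : ∀ {w x y z} → ℚ.0ℚ ℚ.≤ w → ℚ.0ℚ ℚ.≤ y → w ℚ.≤ x → y ℚ.≤ z → w ℚ.* y ℚ.≤ x ℚ.* z
*-mono-≤-nonNeg {w} {x} {y} {z} 0≤w 0≤y w≤x y≤z = ℚ.≤-trans
  (ℚ.*-monoʳ-≤-nonNeg y {{ℚ.nonNegative 0≤y}} w≤x)
  (ℚ.*-monoˡ-≤-nonNeg x {{ℚ.nonNegative (ℚ.≤-trans 0≤w w≤x)}} y≤z)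

^ᵠ-nonNeg : ∀ {x} k → ℚ.0ℚ ℚ.≤ x → ℚ.0ℚ ℚ.≤ x ^ᵠ k
^ᵠ-nonNeg zero    0≤x = fromℕ-nonNeg 1
^ᵠ-nonNeg (suc k) 0≤x = *-mono-≤-nonNeg ℚ.≤-refl ℚ.≤-refl 0≤x (^ᵠ-nonNeg k 0≤x)

^ᵠ-mono-≤ : ∀ {x y} k → ℚ.0ℚ ℚ.≤ x → x ℚ.≤ y → x ^ᵠ k ℚ.≤ y ^ᵠ k
^ᵠ-mono-≤ zero    0≤x x≤y = ℚ.≤-refl
^ᵠ-mono-≤ (suc k) 0≤x x≤y = *-mono-≤-nonNeg 0≤x (^ᵠ-nonNeg k 0≤x) x≤y (^ᵠ-mono-≤ k 0≤x x≤y)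

value-nonNeg : ∀ p → ℚ.0ℚ ℚ.≤ value p
value-nonNeg (p , pos) = ℚ.<⇒≤ (ℚ.positive⁻¹ p {{pos}})

den>0 : ∀ p → 0 < den p
den>0 (mkℚ _ _ _ , _) = z<s

value-≤-fromℕ : ∀ p m → num p ≤ m * den p → value p ℚ.≤ fromℕ m
value-≤-fromℕ (mkℚ +[1+ a ] d _ , _) m le = ℚ.toℚᵘ-cancel-≤ (ℚᵘ.≤-respʳ-≃ (ℚᵘ.≃-sym (toℚᵘ-fromℕ m))
  (ℚᵘ.*≤* (subst₂ ℤ._≤_ (sym (ℤ.*-identityʳ +[1+ a ])) (ℤ.pos-* m (suc d)) (ℤ.+≤+ le))))

fromℕ-≤-value : ∀ p m → m * den p ≤ num p → fromℕ m ℚ.≤ value p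
fromℕ-≤-value (mkℚ +[1+ a ] d _ , _) m le = ℚ.toℚᵘ-cancel-≤ (ℚᵘ.≤-respˡ-≃ (ℚᵘ.≃-sym (toℚᵘ-fromℕ m))
  (ℚᵘ.*≤* (subst₂ ℤ._≤_ (ℤ.pos-* m (suc d)) (sym (ℤ.*-identityʳ +[1+ a ])) (ℤ.+≤+ le))))

clear-denominators : ∀ p v c m → value p ℚ.* (fromℕ c ℚ.* value v) ℚ.≤ fromℕ m →
                     num p * (c * num v) ≤ m * (den p * den v)
clear-denominators (p@(mkℚ +[1+ a ] b _) , _) (v@(mkℚ +[1+ e ] f _) , _) c m le =
  ℤ.drop‿+≤+ (subst₂ ℤ._≤_ left right
    (ℚᵘ.drop-*≤* (ℚᵘ.≤-respʳ-≃ (toℚᵘ-fromℕ m) (ℚᵘ.≤-respˡ-≃ lhs (ℚ.toℚᵘ-mono-≤ le)))))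
  where
  lhs : toℚᵘ (p ℚ.* (fromℕ c ℚ.* v)) ℚᵘ.≃ toℚᵘ p ℚᵘ.* (mkℚᵘ (ℤ.+ c) 0 ℚᵘ.* toℚᵘ v)
  lhs = ℚᵘ.≃-trans (ℚ.toℚᵘ-homo-* p (fromℕ c ℚ.* v)) (ℚᵘ.*-congˡ {toℚᵘ p}
    (ℚᵘ.≃-trans (ℚ.toℚᵘ-homo-* (fromℕ c) v) (ℚᵘ.*-congʳ {toℚᵘ v} (toℚᵘ-fromℕ c))))
  left : (+[1+ a ] ℤ.* (ℤ.+ c ℤ.* +[1+ e ])) ℤ.* ℤ.+ 1 ≡ ℤ.+ (suc a * (c * suc e))
  left = trans (ℤ.*-identityʳ _) (trans (cong (+[1+ a ] ℤ.*_) (sym (ℤ.pos-* c (suc e))))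
    (sym (ℤ.pos-* (suc a) (c * suc e))))
  right : ℤ.+ m ℤ.* ℤ.+ (suc b * (1 * suc f)) ≡ ℤ.+ (m * (suc b * suc f))
  right = trans (sym (ℤ.pos-* m _)) (cong (λ z → ℤ.+ (m * (suc b * z))) (*-identityˡ (suc f)))

2^-cancel-≤ : ∀ {m k} → 2 ^ m ≤ 2 ^ k → m ≤ k
2^-cancel-≤ 2^m≤2^k = ≮⇒≥ λ k<m → ≤⇒≯ 2^m≤2^k (^-monoʳ-< 2 (s≤s (s≤s z≤n)) k<m)

-- The fractions P / D and V / E stand for the exponent and for a rational above log₂ log₂ n.
exponent-bound : ∀ {n r ℓ} → 2 ^ ℓ ≤ n → n < 2 ^ suc ℓ →
  (∀ P D V E → 0 < D → 0 < E → r ^ D ≤ n ^ P → P * (20 * V) ≤ suc ℓ * (D * E) → ℓ ^ E ≤ 2 ^ V → ⊥) →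
  ι n ^ᴿ (log₂ (ι n) /ᴿ (ι 20 *ᴿ log₂ (log₂ (ι n)))) ≤ᴿ ι r
exponent-bound {n} {r} {ℓ} 2^ℓ≤n n<2^ absurd q
  -- Unfolded cuts: `p` is below the exponent because `p * b ≤ s`, where `s` is below `log₂ n` and
  -- `b ≥ u * v` with `u > 20` and `v` above `log₂ log₂ n`. The last fact comes from `x` above
  -- `log₂ n` with `x ≤ 2 ^ v`.
  (a , p , a<n , (s , b , (s′ , s′<n , 2^s≤s′) , (u , v , 20<u , (x , (y , n<y , y≤2^x) , x≤2^v) , uv≤b) , pb≤s) , q≤a^p)
  with value q ℚ.<? fromℕ r
... | yes q<r = q<r
... | no  q≮r = ⊥-elim (absurd (num p) (den p) (num v) (den v) (den>0 p) (den>0 v)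
    (fromℕ-cancel-≤ (subst₂ ℚ._≤_ (fromℕ-^ r (den p)) (fromℕ-^ n (num p)) r^≤n^))
    (clear-denominators p v 20 (suc ℓ) p·20·v≤1+ℓ)
    (fromℕ-cancel-≤ (subst₂ ℚ._≤_ (fromℕ-^ ℓ (den v)) (fromℕ-^ 2 (num v)) ℓ^≤2^)))
  where
  open ℚ.≤-Reasoning
  r^≤n^ : fromℕ r ^ᵠ den p ℚ.≤ fromℕ n ^ᵠ num p
  r^≤n^ = begin
    fromℕ r ^ᵠ den p   ≤⟨ ^ᵠ-mono-≤ (den p) (fromℕ-nonNeg r) (ℚ.≮⇒≥ q≮r) ⟩
    value q ^ᵠ den p   ≤⟨ q≤a^p ⟩
    value a ^ᵠ num p   ≤⟨ ^ᵠ-mono-≤ (num p) (value-nonNeg a) (ℚ.<⇒≤ a<n) ⟩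
    fromℕ n ^ᵠ num p   ∎

  -- The outer logarithm is rounded up to `suc ℓ` and, in `ℓ≤x`, the inner one down to `ℓ`; both
  -- roundings can only enlarge the exponent to be beaten.
  s≤1+ℓ : value s ℚ.≤ fromℕ (suc ℓ)
  s≤1+ℓ = value-≤-fromℕ s (suc ℓ) (2^-cancel-≤ (≤-trans
    (fromℕ-cancel-≤ (begin
      fromℕ (2 ^ num s)  ≡⟨ fromℕ-^ 2 (num s) ⟨
      fromℕ 2 ^ᵠ num s   ≤⟨ 2^s≤s′ ⟩
      value s′ ^ᵠ den s  ≤⟨ ^ᵠ-mono-≤ (den s) (value-nonNeg s′) (ℚ.<⇒≤ s′<n) ⟩
      fromℕ n ^ᵠ den s   ≡⟨ fromℕ-^ n (den s) ⟩
      fromℕ (n ^ den s)  ∎))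
    (≤-trans (^-monoˡ-≤ (den s) (<⇒≤ n<2^)) (≤-reflexive (^-*-assoc 2 (suc ℓ) (den s))))))

  ℓ≤x : fromℕ ℓ ℚ.≤ value x
  ℓ≤x = fromℕ-≤-value x ℓ (2^-cancel-≤ (≤-trans
    (≤-trans (≤-reflexive (sym (^-*-assoc 2 ℓ (den x)))) (^-monoˡ-≤ (den x) 2^ℓ≤n))
    (fromℕ-cancel-≤ (begin
      fromℕ (n ^ den x)  ≡⟨ fromℕ-^ n (den x) ⟨
      fromℕ n ^ᵠ den x   ≤⟨ ^ᵠ-mono-≤ (den x) (fromℕ-nonNeg n) (ℚ.<⇒≤ n<y) ⟩
      value y ^ᵠ den x   ≤⟨ y≤2^x ⟩
      fromℕ 2 ^ᵠ num x   ≡⟨ fromℕ-^ 2 (num x) ⟩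
      fromℕ (2 ^ num x)  ∎))))

  ℓ^≤2^ : fromℕ ℓ ^ᵠ den v ℚ.≤ fromℕ 2 ^ᵠ num v
  ℓ^≤2^ = ℚ.≤-trans (^ᵠ-mono-≤ (den v) (fromℕ-nonNeg ℓ) ℓ≤x) x≤2^v

  20·v-nonNeg : ℚ.0ℚ ℚ.≤ fromℕ 20 ℚ.* value v
  20·v-nonNeg = *-mono-≤-nonNeg ℚ.≤-refl ℚ.≤-refl (fromℕ-nonNeg 20) (value-nonNeg v)

  p·20·v≤1+ℓ : value p ℚ.* (fromℕ 20 ℚ.* value v) ℚ.≤ fromℕ (suc ℓ)
  p·20·v≤1+ℓ = begin
    value p ℚ.* (fromℕ 20 ℚ.* value v)
      ≤⟨ *-mono-≤-nonNeg (value-nonNeg p) 20·v-nonNeg ℚ.≤-refl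
           (*-mono-≤-nonNeg (fromℕ-nonNeg 20) (value-nonNeg v) (ℚ.<⇒≤ 20<u) ℚ.≤-refl) ⟩
    value p ℚ.* (value u ℚ.* value v)
      ≤⟨ *-mono-≤-nonNeg (value-nonNeg p)
           (*-mono-≤-nonNeg ℚ.≤-refl ℚ.≤-refl (value-nonNeg u) (value-nonNeg v)) ℚ.≤-refl uv≤b ⟩
    value p ℚ.* value b                  ≤⟨ pb≤s ⟩
    value s                              ≤⟨ s≤1+ℓ ⟩
    fromℕ (suc ℓ)                        ∎

-- Numerical estimates

^-*-comm : ∀ m n o → (m ^ n) ^ o ≡ (m ^ o) ^ n
^-*-comm m n o = trans (^-*-assoc m n o) (trans (cong (m ^_) (*-comm n o)) (sym (^-*-assoc m o n)))

^-distribʳ-* : ∀ m n o → (m * n) ^ o ≡ m ^ o * n ^ o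
^-distribʳ-* m n zero    = refl
^-distribʳ-* m n (suc o) = trans (cong (m * n *_) (^-distribʳ-* m n o)) (interchange m n (m ^ o) (n ^ o))
  where
  interchange : ∀ a b c d → a * b * (c * d) ≡ a * c * (b * d)
  interchange = solve-∀

⌊log⌋ : ∀ b n → 2 ≤ b → 1 ≤ n → ∃[ d ] b ^ d ≤ n × n < b ^ suc d
⌊log⌋ b (suc zero)    2≤b _ = 0 , ≤-refl , subst (2 ≤_) (sym (*-identityʳ b)) 2≤b
⌊log⌋ b (suc (suc n)) 2≤b _ with ⌊log⌋ b (suc n) 2≤b (s≤s z≤n)
... | d , lo , hi with m≤n⇒m<n∨m≡n hi
...   | inj₁ 2+n<b^ = d , m≤n⇒m≤1+n lo , 2+n<b^
...   | inj₂ 2+n≡b^ = suc d , ≤-reflexive (sym 2+n≡b^) ,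
        subst (_< b ^ suc (suc d)) (sym 2+n≡b^) (^-monoʳ-< b 2≤b (n<1+n (suc d)))

-- Here the exponent is at most 1.
exponent-small : ∀ {n r ℓ} c → 1 < n → n ≤ r → 2 ^ c ≤ ℓ → suc ℓ < 20 * c →
  ∀ P D V E → 0 < D → 0 < E → r ^ D ≤ n ^ P → P * (20 * V) ≤ suc ℓ * (D * E) → ℓ ^ E ≤ 2 ^ V → ⊥
exponent-small {n} {r} {ℓ} c 1<n n≤r 2^c≤ℓ 1+ℓ<20c P D V E 0<D 0<E r^D≤n^P P20V≤ ℓ^E≤2^V =
  <-irrefl refl (begin-strict
    D * (20 * V)      ≤⟨ *-monoˡ-≤ (20 * V) D≤P ⟩
    P * (20 * V)      ≤⟨ P20V≤ ⟩
    suc ℓ * (D * E)   <⟨ *-monoˡ-< (D * E) {{m*n≢0 D E {{>-nonZero 0<D}} {{>-nonZero 0<E}}}} 1+ℓ<20c ⟩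
    20 * c * (D * E)  ≡⟨ rearrange c D E ⟩
    D * (20 * (c * E)) ≤⟨ *-monoʳ-≤ D (*-monoʳ-≤ 20 cE≤V) ⟩
    D * (20 * V)      ∎)
  where
  open ≤-Reasoning
  rearrange : ∀ c d e → 20 * c * (d * e) ≡ d * (20 * (c * e))
  rearrange = solve-∀
  -- A violation gives `n ^ D ≤ r ^ D ≤ n ^ P`, hence `P / D ≥ 1`, whereas `V / E ≥ c` forces
  -- `P / D ≤ (ℓ + 1) / (20 * c) < 1`.
  D≤P : D ≤ P
  D≤P = ≮⇒≥ λ P<D → <⇒≱ (^-monoʳ-< n 1<n P<D) (≤-trans (^-monoˡ-≤ D n≤r) r^D≤n^P)
  cE≤V : c * E ≤ V
  cE≤V = 2^-cancel-≤ (begin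
    2 ^ (c * E)  ≡⟨ ^-*-assoc 2 c E ⟨
    (2 ^ c) ^ E  ≤⟨ ^-monoˡ-≤ E 2^c≤ℓ ⟩
    ℓ ^ E        ≤⟨ ℓ^E≤2^V ⟩
    2 ^ V        ∎)

-- Put `p = P / D`, `v = V / E` and `B = 2 * suc τ`. From `(2 ^ τ) ^ d < r` comes
-- `τ * d ≤ (ℓ + 1) * p`; from `2 * B ≤ ℓ` and `2 ^ (2 + τ) < B ^ d` comes `2 + τ + d < d * v`.
-- Together they give `20 * τ * (2 + τ) < (ℓ + 1) ^ 2 ≤ 16 * (2 + τ) ^ 2`, and `8 ≤ τ` closes the
-- gap between 16 and 20.
exponent-large : ∀ {n r ℓ τ d} → 8 ≤ τ → 4 * suc τ ≤ ℓ → suc ℓ ≤ 4 * (2 + τ) → n < 2 ^ suc ℓ →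
  2 ^ (2 + τ) < (2 * suc τ) ^ d → (2 ^ τ) ^ d < r →
  ∀ P D V E → 0 < D → 0 < E → r ^ D ≤ n ^ P → P * (20 * V) ≤ suc ℓ * (D * E) → ℓ ^ E ≤ 2 ^ V → ⊥
exponent-large {n} {r} {ℓ} {τ} {d} 8≤τ 4m≤ℓ 1+ℓ≤ n<2^ 2^<B^d t^d<r P D V E 0<D 0<E r^D≤n^P P20V≤ ℓ^E≤2^V =
  <-irrefl refl (begin-strict
    20 * τ * D * ((2 + τ + d) * E)        <⟨ *-monoʳ-< (20 * τ * D) {{20τD≢0}} exponent> ⟩
    20 * τ * D * (d * V)                  ≡⟨ rearrange₁ τ D d V ⟩
    τ * d * D * (20 * V)                  ≤⟨ *-monoˡ-≤ (20 * V) exponent≤ ⟩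
    suc ℓ * P * (20 * V)                  ≡⟨ *-assoc (suc ℓ) P (20 * V) ⟩
    suc ℓ * (P * (20 * V))                ≤⟨ *-monoʳ-≤ (suc ℓ) P20V≤ ⟩
    suc ℓ * (suc ℓ * (D * E))             ≤⟨ *-mono-≤ 1+ℓ≤ (*-monoˡ-≤ (D * E) 1+ℓ≤) ⟩
    4 * (2 + τ) * (4 * (2 + τ) * (D * E)) ≡⟨ rearrange₂ (2 + τ) D E ⟩
    4 * (4 * (2 + τ)) * D * ((2 + τ) * E) ≤⟨ *-mono-≤ (*-monoˡ-≤ D (*-monoʳ-≤ 4 4[2+τ]≤5τ)) (*-monoˡ-≤ E (m≤m+n (2 + τ) d)) ⟩
    4 * (5 * τ) * D * ((2 + τ + d) * E)   ≡⟨ cong (λ z → z * D * ((2 + τ + d) * E)) (sym (*-assoc 4 5 τ)) ⟩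
    20 * τ * D * ((2 + τ + d) * E)        ∎)
  where
  open ≤-Reasoning
  20τD≢0 : NonZero (20 * τ * D)
  20τD≢0 = m*n≢0 (20 * τ) D {{m*n≢0 20 τ {{_}} {{>-nonZero (<-≤-trans z<s 8≤τ)}}}} {{>-nonZero 0<D}}
  rearrange₁ : ∀ τ D d V → 20 * τ * D * (d * V) ≡ τ * d * D * (20 * V)
  rearrange₁ = solve-∀
  rearrange₂ : ∀ s D E → 4 * s * (4 * s * (D * E)) ≡ 4 * (4 * s) * D * (s * E)
  rearrange₂ = solve-∀
  4[2+τ]≤5τ : 4 * (2 + τ) ≤ 5 * τ
  4[2+τ]≤5τ = begin
    4 * (2 + τ)   ≡⟨ *-distribˡ-+ 4 2 τ ⟩
    8 + 4 * τ     ≤⟨ +-monoˡ-≤ (4 * τ) 8≤τ ⟩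
    5 * τ         ∎
  exponent≤ : τ * d * D ≤ suc ℓ * P
  exponent≤ = 2^-cancel-≤ (begin
    2 ^ (τ * d * D)    ≡⟨ ^-*-assoc 2 (τ * d) D ⟨
    (2 ^ (τ * d)) ^ D  ≡⟨ cong (_^ D) (^-*-assoc 2 τ d) ⟨
    ((2 ^ τ) ^ d) ^ D  ≤⟨ ^-monoˡ-≤ D (<⇒≤ t^d<r) ⟩
    r ^ D              ≤⟨ r^D≤n^P ⟩
    n ^ P              ≤⟨ ^-monoˡ-≤ P (<⇒≤ n<2^) ⟩
    (2 ^ suc ℓ) ^ P    ≡⟨ ^-*-assoc 2 (suc ℓ) P ⟩
    2 ^ (suc ℓ * P)    ∎)
  2·B≤ℓ : 2 * (2 * suc τ) ≤ ℓ
  2·B≤ℓ = ≤-trans (≤-reflexive (sym (*-assoc 2 2 (suc τ)))) 4m≤ℓ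
  exponent> : (2 + τ + d) * E < d * V
  exponent> = ≰⇒> λ dV≤ → <⇒≱ (begin-strict
    2 ^ ((2 + τ + d) * E)               ≡⟨ ^-*-assoc 2 (2 + τ + d) E ⟨
    (2 ^ (2 + τ + d)) ^ E               ≡⟨ cong (_^ E) (^-distribˡ-+-* 2 (2 + τ) d) ⟩
    (2 ^ (2 + τ) * 2 ^ d) ^ E           <⟨ ^-monoˡ-< E {{>-nonZero 0<E}} (*-monoˡ-< (2 ^ d) {{m^n≢0 2 d}} 2^<B^d) ⟩
    ((2 * suc τ) ^ d * 2 ^ d) ^ E       ≡⟨ cong (_^ E) (trans (*-comm ((2 * suc τ) ^ d) (2 ^ d)) (sym (^-distribʳ-* 2 (2 * suc τ) d))) ⟩
    ((2 * (2 * suc τ)) ^ d) ^ E         ≤⟨ ^-monoˡ-≤ E (^-monoˡ-≤ d 2·B≤ℓ) ⟩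
    (ℓ ^ d) ^ E                         ≡⟨ ^-*-comm ℓ d E ⟩
    (ℓ ^ E) ^ d                         ≤⟨ ^-monoˡ-≤ d ℓ^E≤2^V ⟩
    (2 ^ V) ^ d                         ≡⟨ ^-*-assoc 2 V d ⟩
    2 ^ (V * d)                         ≡⟨ cong (2 ^_) (*-comm V d) ⟩
    2 ^ (d * V)                         ∎) (^-monoʳ-≤ 2 dV≤)

-- The two ranges of `n`

LowerBound : ℕ → Set
LowerBound n = Σ[ H ∈ Digraph n ] Acyclic H × maxDegree H ≡ 3 ×
  ((k : ℕ) → 2 ≤ k → (r : ℕ) → IsRamseyNumber k H r →
    ι n ^ᴿ (log₂ (ι n) /ᴿ (ι 20 *ᴿ log₂ (log₂ (ι n)))) ≤ᴿ ι r)

-- Cells of length 3 are long enough for vertex 1 to have degree 3, and `4 ≤ n` leaves room for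
-- vertex 3.
lowerBound-small : ∀ {n ℓ} c → 4 ≤ n → 2 ^ ℓ ≤ n → n < 2 ^ suc ℓ → 2 ^ c ≤ ℓ → suc ℓ < 20 * c → LowerBound n
lowerBound-small {n} c 4≤n 2^ℓ≤n n<2^ 2^c≤ℓ 1+ℓ<20c =
  matchedPath 3 n , matchedPath-acyclic 3 , matchedPath-maxDegree 3 ≤-refl 4≤n ,
  λ k 2≤k r (arrows , _) → exponent-bound 2^ℓ≤n n<2^
    (exponent-small c (<-≤-trans (s≤s (s≤s z≤n)) 4≤n) (arrows⇒≥ 2≤k arrows) 2^c≤ℓ 1+ℓ<20c)

-- Here `q = 2 ^ (2 * suc τ)`, `t = 2 ^ τ`, and cliques have fewer than `B = 2 * suc τ` points. The
-- largest `d` with `B ^ d ≤ q / t = 2 ^ (2 + τ)` is taken, and depth `suc d` is used: its cell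
-- count is at most `t * B ^ d ≤ q`, while `B ^ suc d` exceeds `q / t`.
lowerBound-large : ∀ {n ℓ} τ → 8 ≤ τ → 4 * suc τ ≤ ℓ → suc ℓ ≤ 4 * (2 + τ) → 2 ^ ℓ ≤ n → n < 2 ^ suc ℓ → LowerBound n
lowerBound-large {n} {ℓ} τ 8≤τ 4m≤ℓ 1+ℓ≤ 2^ℓ≤n n<2^
  with χ , noClique ← noClique-2^ τ (≤-trans (s≤s z≤n) 8≤τ)
     | d , B^d≤ , <B^1+d ← ⌊log⌋ (2 * suc τ) (2 ^ (2 + τ)) (*-monoʳ-≤ 2 (s≤s z≤n)) (m^n>0 2 (2 + τ)) =
  matchedPath q n , matchedPath-acyclic q , matchedPath-maxDegree q 3≤q q<n ,
  λ k 2≤k r (arrows , _) → exponent-bound 2^ℓ≤n n<2^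
    (exponent-large {d = suc d} 8≤τ 4m≤ℓ 1+ℓ≤ n<2^ <B^1+d
      (ramsey-lower-bound {d = suc d} 2≤k (≤-trans (n≤1+n 2) 3≤q) q²≤n (cells≤q d B^d≤) noClique arrows))
  where
  open ≤-Reasoning
  q = 2 ^ (2 * suc τ)
  instance
    q≢0 : NonZero q
    q≢0 = m^n≢0 2 (2 * suc τ)
    t≢0 : NonZero (2 ^ τ)
    t≢0 = m^n≢0 2 τ
  3≤q : 3 ≤ q
  3≤q = begin
    3                ≤⟨ n≤1+n 3 ⟩
    2 ^ 2            ≤⟨ ^-monoʳ-≤ 2 (*-monoʳ-≤ 2 (s≤s (z≤n {τ}))) ⟩
    2 ^ (2 * suc τ)  ∎
  q²≤n : q * q ≤ n
  q²≤n = begin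
    q * q                          ≡⟨ ^-distribˡ-+-* 2 (2 * suc τ) (2 * suc τ) ⟨
    2 ^ (2 * suc τ + 2 * suc τ)    ≡⟨ cong (2 ^_) (*-distribʳ-+ (suc τ) 2 2) ⟨
    2 ^ (4 * suc τ)                ≤⟨ ^-monoʳ-≤ 2 4m≤ℓ ⟩
    2 ^ ℓ                          ≤⟨ 2^ℓ≤n ⟩
    n                              ∎
  q<n : q < n
  q<n = <-≤-trans (m<m*n q q (≤-trans (n≤1+n 2) 3≤q)) q²≤n
  cells≤q : ∀ d → (2 * suc τ) ^ d ≤ 2 ^ (2 + τ) → cells (2 ^ τ) (pred (2 * suc τ)) (suc d) ≤ q
  cells≤q d B^d≤ = begin
    cells (2 ^ τ) (pred (2 * suc τ)) (suc d)  ≤⟨ cells-≤ (2 ^ τ) (pred (2 * suc τ)) d ⟩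
    2 ^ τ * (2 * suc τ) ^ d                   ≤⟨ *-monoʳ-≤ (2 ^ τ) B^d≤ ⟩
    2 ^ τ * 2 ^ (2 + τ)                       ≡⟨ ^-distribˡ-+-* 2 τ (2 + τ) ⟨
    2 ^ (τ + (2 + τ))                         ≡⟨ cong (2 ^_) (rearrange τ) ⟩
    q                                         ∎
    where
    rearrange : ∀ τ → τ + (2 + τ) ≡ 2 * suc τ
    rearrange = solve-∀

theorem1p6 : (n : ℕ) → 4 ≤ n →
    Σ[ H ∈ Digraph n ]
    Acyclic H ×
    maxDegree H ≡ 3 ×
    ((k : ℕ) → 2 ≤ k → (r : ℕ) → IsRamseyNumber k H r →
    ι n ^ᴿ (log₂ (ι n) /ᴿ (ι 20 *ᴿ log₂ (log₂ (ι n)))) ≤ᴿ ι r)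
theorem1p6 n 4≤n with ⌊log⌋ 2 n ≤-refl (≤-trans (s≤s z≤n) 4≤n)
-- For `ℓ ≤ 18`, `c = 1` works since `ℓ + 1 < 20`; for `19 ≤ ℓ ≤ 35`, `c = 2` works since
-- `ℓ + 1 < 40`. From 36 on, `ℓ / 4 ≥ 9`, so `τ = ℓ / 4 - 1` is at least 8.
... | ℓ , 2^ℓ≤n , n<2^ with ℓ ≤? 18 | ℓ ≤? 35
...   | yes ℓ≤18 | _        = lowerBound-small 1 4≤n 2^ℓ≤n n<2^ 2≤ℓ (s≤s (s≤s ℓ≤18))
  where
  2≤ℓ : 2 ≤ ℓ
  2≤ℓ = s≤s⁻¹ (≰⇒> λ 1+ℓ≤2 → <⇒≱ n<2^ (≤-trans (^-monoʳ-≤ 2 1+ℓ≤2) 4≤n))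
...   | no  ℓ≰18 | yes ℓ≤35 = lowerBound-small 2 4≤n 2^ℓ≤n n<2^
  (≤-trans (m≤m+n 4 15) (≰⇒> ℓ≰18)) (≤-trans (s≤s (s≤s ℓ≤35)) (m≤m+n 37 3))
...   | no  _    | no ℓ≰35  = lowerBound-large (pred (ℓ / 4)) (pred-mono-≤ 9≤m)
  (subst (λ m → 4 * m ≤ ℓ) (sym m≡) (≤-trans (≤-reflexive (*-comm 4 (ℓ / 4))) (m/n*n≤m ℓ 4)))
  (subst (λ m → suc ℓ ≤ 4 * suc m) (sym m≡) (begin-strict
    ℓ                       ≡⟨ m≡m%n+[m/n]*n ℓ 4 ⟩
    ℓ % 4 + ℓ / 4 * 4       <⟨ +-monoˡ-< (ℓ / 4 * 4) (m%n<n ℓ 4) ⟩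
    suc (ℓ / 4) * 4         ≡⟨ *-comm (suc (ℓ / 4)) 4 ⟩
    4 * suc (ℓ / 4)         ∎))
  2^ℓ≤n n<2^
  where
  open ≤-Reasoning
  9≤m : 9 ≤ ℓ / 4
  9≤m = /-monoˡ-≤ 4 (≰⇒> ℓ≰35)
  m≡ : suc (pred (ℓ / 4)) ≡ ℓ / 4
  m≡ = suc-pred (ℓ / 4) {{>-nonZero (<-≤-trans z<s 9≤m)}}
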